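{- Let $\ell$ be an odd prime and suppose that $|S^2(\ell,T)|=o(T)$ as $T\to\infty$. Then $$|\{1\le n\le X: \Phi_\ell(n)\text{ is square-free}\}|\sim C X \quad\text{as } X\to\infty,$$ where $C=\prod_p\left(1-\frac{\delta(p^2)}{p^2}\right)$ (product over all primes $p$) and $\delta(N)=|\{a \bmod N: \Phi_\ell(a)\equiv 0 \pmod N\}|$.
   Context: $\Phi_\ell(X)$ denotes the $\ell$-th cyclotomic polynomial. For a natural number $n$, $R_\ell(n):=\min\{d\in\mathbb{N}: n\mid \Phi_\ell(d)\}$ if such $d$ exists, and $R_\ell(n)=\infty$ otherwise. $\mathbb{P}$ denotes the set of primes $p$ that divide $\Phi_\ell(d)$ for some $d\in\mathbb{N}$. For real $T$, $S^2(\ell,T):=\{p\in\mathbb{P}: R_\ell(p^2)\le T\}$. -}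

module Defs where

open import Data.Bool using (if_then_else_)
open import Data.Integer as ℤ using (ℤ; +_; 0ℤ; 1ℤ; -1ℤ)
import Data.Integer.Divisibility as ℤ∣
open import Data.List using (List; []; _∷_; _++_; [_]; filter; foldl; length; map; replicate; upTo)
open import Data.List.Membership.Propositional using (_∈_)
open import Data.List.Relation.Unary.Unique.Propositional using (Unique)
open import Data.Nat as ℕ using (ℕ; zero; suc; _∸_; _^_)
import Data.Nat.Divisibility as ℕ∣
import Data.Nat.Properties as ℕ
open import Data.Nat.Primality using (Prime; prime?)
open import Data.Product using (∃; ∃-syntax; _×_; _,_)
open import Data.Rational as ℚ using (ℚ; 0ℚ; 1ℚ; ½; Positive; positive)
import Data.Rational.Properties as ℚ
import Data.Rational.Solver as ℚ
open import Data.Sum using (inj₁; inj₂)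
open import Function using (_⇔_)
open import Level using (0ℓ)
open import Relation.Binary.PropositionalEquality
  using (_≡_; refl; sym; trans; cong; cong₂; subst)
open import Relation.Nullary using (does)
open import Relation.Unary using (Pred)

IsCauchy : (ℕ → ℚ) → Set
IsCauchy x = ∀ ε → 0ℚ ℚ.< ε →
  ∃[ N ] ∀ m n → N ℕ.≤ m → N ℕ.≤ n → ℚ.∣ x m ℚ.- x n ∣ ℚ.≤ ε

record ℝ : Set where
  constructor mkℝ
  field
    seq    : ℕ → ℚ
    cauchy : IsCauchy seq

open ℝ public

private
  open ℚ.+-*-Solver
  open ℚ.≤-Reasoning

  0<½* : ∀ {ε} → 0ℚ ℚ.< ε → 0ℚ ℚ.< ½ ℚ.* ε
  0<½* {ε} 0<ε = subst (ℚ._< ½ ℚ.* ε) (ℚ.*-zeroʳ ½) (ℚ.*-monoʳ-<-pos ½ 0<ε)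

  halves : ∀ ε → ½ ℚ.* ε ℚ.+ ½ ℚ.* ε ≡ ε
  halves ε = trans (sym (ℚ.*-distribʳ-+ ε ½ ½)) (ℚ.*-identityˡ ε)

  cauchy-const : ∀ q → IsCauchy (λ _ → q)
  cauchy-const q ε 0<ε = 0 , λ _ _ _ _ → begin
    ℚ.∣ q ℚ.- q ∣  ≡⟨ cong ℚ.∣_∣ (ℚ.+-inverseʳ q) ⟩
    0ℚ             ≤⟨ ℚ.<⇒≤ 0<ε ⟩
    ε              ∎

  cauchy-- : ∀ x y → IsCauchy x → IsCauchy y → IsCauchy (λ n → x n ℚ.- y n)
  cauchy-- x y cx cy ε 0<ε
    with cx (½ ℚ.* ε) (0<½* 0<ε) | cy (½ ℚ.* ε) (0<½* 0<ε)
  ... | M , hx | N , hy = M ℕ.⊔ N , λ m n p q → begin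
    ℚ.∣ (x m ℚ.- y m) ℚ.- (x n ℚ.- y n) ∣
      ≡⟨ cong ℚ.∣_∣ (solve 4 (λ a b c d →
           (a :- b) :- (c :- d) := (a :- c) :- (b :- d)) refl (x m) (y m) (x n) (y n)) ⟩
    ℚ.∣ (x m ℚ.- x n) ℚ.- (y m ℚ.- y n) ∣
      ≤⟨ ℚ.∣p-q∣≤∣p∣+∣q∣ (x m ℚ.- x n) (y m ℚ.- y n) ⟩
    ℚ.∣ x m ℚ.- x n ∣ ℚ.+ ℚ.∣ y m ℚ.- y n ∣
      ≤⟨ ℚ.+-mono-≤ (hx m n (ℕ.m⊔n≤o⇒m≤o M N p) (ℕ.m⊔n≤o⇒m≤o M N q))
                    (hy m n (ℕ.m⊔n≤o⇒n≤o M N p) (ℕ.m⊔n≤o⇒n≤o M N q)) ⟩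
    ½ ℚ.* ε ℚ.+ ½ ℚ.* ε
      ≡⟨ halves ε ⟩
    ε ∎

  ∣-∣-triangle : ∀ p q → ℚ.∣ p ∣ ℚ.- ℚ.∣ q ∣ ℚ.≤ ℚ.∣ p ℚ.- q ∣
  ∣-∣-triangle p q = begin
    ℚ.∣ p ∣ ℚ.- ℚ.∣ q ∣
      ≡⟨ cong (λ r → ℚ.∣ r ∣ ℚ.- ℚ.∣ q ∣) (solve 2 (λ a b → a := (a :- b) :+ b) refl p q) ⟩
    ℚ.∣ (p ℚ.- q) ℚ.+ q ∣ ℚ.- ℚ.∣ q ∣
      ≤⟨ ℚ.+-monoˡ-≤ (ℚ.- ℚ.∣ q ∣) (ℚ.∣p+q∣≤∣p∣+∣q∣ (p ℚ.- q) q) ⟩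
    (ℚ.∣ p ℚ.- q ∣ ℚ.+ ℚ.∣ q ∣) ℚ.- ℚ.∣ q ∣
      ≡⟨ solve 2 (λ a b → (a :+ b) :- b := a) refl ℚ.∣ p ℚ.- q ∣ ℚ.∣ q ∣ ⟩
    ℚ.∣ p ℚ.- q ∣ ∎

  ∣-∣-lipschitz : ∀ p q → ℚ.∣ ℚ.∣ p ∣ ℚ.- ℚ.∣ q ∣ ∣ ℚ.≤ ℚ.∣ p ℚ.- q ∣
  ∣-∣-lipschitz p q with ℚ.∣p∣≡p∨∣p∣≡-p (ℚ.∣ p ∣ ℚ.- ℚ.∣ q ∣)
  ... | inj₁ eq = subst (ℚ._≤ ℚ.∣ p ℚ.- q ∣) (sym eq) (∣-∣-triangle p q)
  ... | inj₂ eq = begin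
    ℚ.∣ ℚ.∣ p ∣ ℚ.- ℚ.∣ q ∣ ∣  ≡⟨ eq ⟩
    ℚ.- (ℚ.∣ p ∣ ℚ.- ℚ.∣ q ∣)  ≡⟨ solve 2 (λ a b → :- (a :- b) := b :- a) refl ℚ.∣ p ∣ ℚ.∣ q ∣ ⟩
    ℚ.∣ q ∣ ℚ.- ℚ.∣ p ∣        ≤⟨ ∣-∣-triangle q p ⟩
    ℚ.∣ q ℚ.- p ∣              ≡⟨ cong ℚ.∣_∣ (solve 2 (λ a b → b :- a := :- (a :- b)) refl p q) ⟩
    ℚ.∣ ℚ.- (p ℚ.- q) ∣        ≡⟨ ℚ.∣-p∣≡∣p∣ (p ℚ.- q) ⟩
    ℚ.∣ p ℚ.- q ∣              ∎

  cauchy-∣∣ : ∀ x → IsCauchy x → IsCauchy (λ n → ℚ.∣ x n ∣)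
  cauchy-∣∣ x cx ε 0<ε with cx ε 0<ε
  ... | N , h = N , λ m n p q → ℚ.≤-trans (∣-∣-lipschitz (x m) (x n)) (h m n p q)

  bounded : ∀ x → IsCauchy x →
    ∃[ B ] ∃[ N ] Positive B × (∀ n → N ℕ.≤ n → ℚ.∣ x n ∣ ℚ.≤ B)
  bounded x cx with cx 1ℚ (ℚ.positive⁻¹ 1ℚ)
  ... | N , h = B , N , positive 0<B , λ n N≤n → begin
    ℚ.∣ x n ∣
      ≡⟨ cong ℚ.∣_∣ (solve 2 (λ a b → a := (a :- b) :+ b) refl (x n) (x N)) ⟩
    ℚ.∣ (x n ℚ.- x N) ℚ.+ x N ∣
      ≤⟨ ℚ.∣p+q∣≤∣p∣+∣q∣ (x n ℚ.- x N) (x N) ⟩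
    ℚ.∣ x n ℚ.- x N ∣ ℚ.+ ℚ.∣ x N ∣
      ≤⟨ ℚ.+-monoˡ-≤ ℚ.∣ x N ∣ (h n N N≤n ℕ.≤-refl) ⟩
    B ∎
    where
    B = 1ℚ ℚ.+ ℚ.∣ x N ∣
    0<B : 0ℚ ℚ.< B
    0<B = ℚ.+-mono-<-≤ (ℚ.positive⁻¹ 1ℚ) (ℚ.0≤∣p∣ (x N))

  scale : ∀ B .{{_ : Positive B}} ε → 0ℚ ℚ.< ε → ∃[ η ] 0ℚ ℚ.< η × B ℚ.* η ≡ ε
  scale B ε 0<ε = B⁻¹ ℚ.* ε
    , subst (ℚ._< B⁻¹ ℚ.* ε) (ℚ.*-zeroʳ B⁻¹) (ℚ.*-monoʳ-<-pos B⁻¹ {{ℚ.1/pos⇒pos B}} 0<ε)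
    , trans (sym (ℚ.*-assoc B B⁻¹ ε))
        (trans (cong (ℚ._* ε) (ℚ.*-inverseʳ B {{ℚ.pos⇒nonZero B}})) (ℚ.*-identityˡ ε))
    where B⁻¹ = (ℚ.1/ B) {{ℚ.pos⇒nonZero B}}

  *-mono-∣∣ : ∀ {b} c {a d} → Positive b → ℚ.∣ c ∣ ℚ.≤ b → ℚ.∣ a ∣ ℚ.≤ d →
    ℚ.∣ c ℚ.* a ∣ ℚ.≤ b ℚ.* d
  *-mono-∣∣ {b} c {a} {d} b>0 c≤b a≤d = begin
    ℚ.∣ c ℚ.* a ∣        ≡⟨ ℚ.∣p*q∣≡∣p∣*∣q∣ c a ⟩
    ℚ.∣ c ∣ ℚ.* ℚ.∣ a ∣  ≤⟨ ℚ.*-monoʳ-≤-nonNeg ℚ.∣ a ∣ {{ℚ.∣-∣-nonNeg a}} c≤b ⟩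
    b ℚ.* ℚ.∣ a ∣        ≤⟨ ℚ.*-monoˡ-≤-nonNeg b {{ℚ.pos⇒nonNeg b {{b>0}}}} a≤d ⟩
    b ℚ.* d              ∎

  *-difference : ∀ a b c d →
    a ℚ.* b ℚ.- c ℚ.* d ≡ a ℚ.* (b ℚ.- d) ℚ.+ d ℚ.* (a ℚ.- c)
  *-difference = solve 4 (λ a b c d →
    a :* b :- c :* d := a :* (b :- d) :+ d :* (a :- c)) refl

  cauchy-* : ∀ x y → IsCauchy x → IsCauchy y → IsCauchy (λ n → x n ℚ.* y n)
  cauchy-* x y cx cy ε 0<ε =
    let A , K , A>0 , hA = bounded x cx
        B , L , B>0 , hB = bounded y cy
        α , 0<α , Aα≡    = scale A {{A>0}} (½ ℚ.* ε) (0<½* 0<ε)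
        β , 0<β , Bβ≡    = scale B {{B>0}} (½ ℚ.* ε) (0<½* 0<ε)
        M , hx           = cx β 0<β
        N , hy           = cy α 0<α
    in (K ℕ.⊔ L) ℕ.⊔ (M ℕ.⊔ N) ,
       combine A>0 B>0 hA hB Aα≡ Bβ≡ hx hy
    where
    combine : ∀ {A B α β K L M N} → Positive A → Positive B →
      (∀ n → K ℕ.≤ n → ℚ.∣ x n ∣ ℚ.≤ A) →
      (∀ n → L ℕ.≤ n → ℚ.∣ y n ∣ ℚ.≤ B) →
      A ℚ.* α ≡ ½ ℚ.* ε → B ℚ.* β ≡ ½ ℚ.* ε →
      (∀ m n → M ℕ.≤ m → M ℕ.≤ n → ℚ.∣ x m ℚ.- x n ∣ ℚ.≤ β) →
      (∀ m n → N ℕ.≤ m → N ℕ.≤ n → ℚ.∣ y m ℚ.- y n ∣ ℚ.≤ α) →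
      ∀ m n → (K ℕ.⊔ L) ℕ.⊔ (M ℕ.⊔ N) ℕ.≤ m → (K ℕ.⊔ L) ℕ.⊔ (M ℕ.⊔ N) ℕ.≤ n →
      ℚ.∣ x m ℚ.* y m ℚ.- x n ℚ.* y n ∣ ℚ.≤ ε
    combine {A} {B} {α} {β} {K} {L} {M} {N} A>0 B>0 hA hB Aα≡ Bβ≡ hx hy m n p q = begin
      ℚ.∣ x m ℚ.* y m ℚ.- x n ℚ.* y n ∣
        ≡⟨ cong ℚ.∣_∣ (*-difference (x m) (y m) (x n) (y n)) ⟩
      ℚ.∣ x m ℚ.* (y m ℚ.- y n) ℚ.+ y n ℚ.* (x m ℚ.- x n) ∣
        ≤⟨ ℚ.∣p+q∣≤∣p∣+∣q∣ (x m ℚ.* (y m ℚ.- y n)) (y n ℚ.* (x m ℚ.- x n)) ⟩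
      ℚ.∣ x m ℚ.* (y m ℚ.- y n) ∣ ℚ.+ ℚ.∣ y n ℚ.* (x m ℚ.- x n) ∣
        ≤⟨ ℚ.+-mono-≤ (*-mono-∣∣ (x m) A>0 (hA m (K≤ p)) (hy m n (N≤ p) (N≤ q)))
                      (*-mono-∣∣ (y n) B>0 (hB n (L≤ q)) (hx m n (M≤ p) (M≤ q))) ⟩
      A ℚ.* α ℚ.+ B ℚ.* β
        ≡⟨ cong₂ ℚ._+_ Aα≡ Bβ≡ ⟩
      ½ ℚ.* ε ℚ.+ ½ ℚ.* ε
        ≡⟨ halves ε ⟩
      ε ∎
      where
      module _ {k} (r : (K ℕ.⊔ L) ℕ.⊔ (M ℕ.⊔ N) ℕ.≤ k) where
        K⊔L≤ : K ℕ.⊔ L ℕ.≤ k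
        K⊔L≤ = ℕ.m⊔n≤o⇒m≤o (K ℕ.⊔ L) (M ℕ.⊔ N) r
        M⊔N≤ : M ℕ.⊔ N ℕ.≤ k
        M⊔N≤ = ℕ.m⊔n≤o⇒n≤o (K ℕ.⊔ L) (M ℕ.⊔ N) r
        K≤ : K ℕ.≤ k
        K≤ = ℕ.m⊔n≤o⇒m≤o K L K⊔L≤
        L≤ : L ℕ.≤ k
        L≤ = ℕ.m⊔n≤o⇒n≤o K L K⊔L≤
        M≤ : M ℕ.≤ k
        M≤ = ℕ.m⊔n≤o⇒m≤o M N M⊔N≤
        N≤ : N ℕ.≤ k
        N≤ = ℕ.m⊔n≤o⇒n≤o M N M⊔N≤

fromℚ : ℚ → ℝ
fromℚ q = mkℝ (λ _ → q) (cauchy-const q)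

fromℕ : ℕ → ℝ
fromℕ n = fromℚ (+ n ℚ./ 1)

infixl 6 _-ᴿ_
infixl 7 _*ᴿ_
infix  4 _≤ᴿ_ _⟶_

_-ᴿ_ : ℝ → ℝ → ℝ
x -ᴿ y = mkℝ (λ n → seq x n ℚ.- seq y n) (cauchy-- (seq x) (seq y) (cauchy x) (cauchy y))

_*ᴿ_ : ℝ → ℝ → ℝ
x *ᴿ y = mkℝ (λ n → seq x n ℚ.* seq y n) (cauchy-* (seq x) (seq y) (cauchy x) (cauchy y))

∣_∣ᴿ : ℝ → ℝ
∣ x ∣ᴿ = mkℝ (λ n → ℚ.∣ seq x n ∣) (cauchy-∣∣ (seq x) (cauchy x))

-- The slack ε makes this an order on the represented reals, independent of
-- the chosen sequences; equality of reals is _≤ᴿ_ in both directions.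
_≤ᴿ_ : ℝ → ℝ → Set
x ≤ᴿ y = ∀ ε → 0ℚ ℚ.< ε → ∃[ N ] ∀ n → N ℕ.≤ n → seq x n ℚ.≤ seq y n ℚ.+ ε

_⟶_ : (ℕ → ℚ) → ℝ → Set
x ⟶ L = ∀ ε → 0ℚ ℚ.< ε → ∃[ N ] ∀ n → N ℕ.≤ n → ∣ fromℚ (x n) -ᴿ L ∣ᴿ ≤ᴿ fromℚ ε

HasCardinality : Pred ℕ 0ℓ → ℕ → Set
HasCardinality A k =
  ∃[ xs ] Unique xs × length xs ≡ k × (∀ n → n ∈ xs ⇔ A n)

Eventually : Pred ℝ 0ℓ → Set
Eventually P = ∃[ X₀ ] ∀ X → X₀ ≤ᴿ X → P X

-- The cardinality of a finite set depending on a real parameter is not a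
-- computable function of that parameter, so it enters through its graph.
-- Asymptotic equivalence is written without division: ∣A X∣ − g X = o(g X).

∣_∣=o_ : (ℝ → Pred ℕ 0ℓ) → (ℝ → ℝ) → Set
∣ A ∣=o g = ∀ ε → 0ℚ ℚ.< ε → Eventually λ X →
  ∀ k → HasCardinality (A X) k → fromℕ k ≤ᴿ fromℚ ε *ᴿ ∣ g X ∣ᴿ

∣_∣∼_ : (ℝ → Pred ℕ 0ℓ) → (ℝ → ℝ) → Set
∣ A ∣∼ g = ∀ ε → 0ℚ ℚ.< ε → Eventually λ X →
  ∀ k → HasCardinality (A X) k → ∣ fromℕ k -ᴿ g X ∣ᴿ ≤ᴿ fromℚ ε *ᴿ ∣ g X ∣ᴿ

-- Coefficient lists, leading coefficient first.
Poly : Set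
Poly = List ℤ

_⟨_⟩ : Poly → ℤ → ℤ
f ⟨ x ⟩ = foldl (λ acc a → acc ℤ.* x ℤ.+ a) 0ℤ f

-- f − c · g, aligned at the leading coefficients.
subtractScaled : ℤ → Poly → Poly → Poly
subtractScaled c []      f       = f
subtractScaled c (b ∷ g) []      = []
subtractScaled c (b ∷ g) (a ∷ f) = (a ℤ.- c ℤ.* b) ∷ subtractScaled c g f

-- The first k quotient coefficients in the long division of f by the monic
-- polynomial 1 ∷ g.
longDivision : ℕ → Poly → Poly → Poly
longDivision zero    f       g = []
longDivision (suc k) []      g = []
longDivision (suc k) (a ∷ f) g = a ∷ longDivision k (subtractScaled a g f) g

-- Quotient of f by a monic polynomial; the leading coefficient of the divisor
-- is taken to be 1.
_÷_ : Poly → Poly → Poly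
f ÷ []      = []
f ÷ (_ ∷ g) = longDivision (length f ∸ length g) f g

-- Xⁿ − 1.
unityPolynomial : ℕ → Poly
unityPolynomial zero    = []
unityPolynomial (suc n) = 1ℤ ∷ replicate n 0ℤ ++ [ -1ℤ ]

properDivisors : ℕ → List ℕ
properDivisors n = filter (ℕ∣._∣? n) (upTo n)

-- Xⁿ − 1 = ∏_{d ∣ n} Φ_d, solved recursively for Φₙ.  The first argument
-- bounds the recursion depth; n suffices, since proper divisors of n are < n.
cyclotomicWithin : ℕ → ℕ → Poly
cyclotomicWithin zero    n = [ 1ℤ ]
cyclotomicWithin (suc b) n =
  foldl _÷_ (unityPolynomial n) (map (cyclotomicWithin b) (properDivisors n))

cyclotomic : ℕ → Poly
cyclotomic n = cyclotomicWithin n n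

Φ : ℕ → ℕ → ℤ
Φ ℓ n = cyclotomic ℓ ⟨ + n ⟩

SquareFree : ℤ → Set
SquareFree z = ∀ (d : ℤ) → d ℤ.* d ℤ∣.∣ z → ℤ.∣ d ∣ ≡ 1

SquareFreeArguments : ℕ → ℝ → Pred ℕ 0ℓ
SquareFreeArguments ℓ X n = 1 ℕ.≤ n × fromℕ n ≤ᴿ X × SquareFree (Φ ℓ n)

IsMinimum : Pred ℕ 0ℓ → ℕ → Set
IsMinimum A d = A d × (∀ e → A e → d ℕ.≤ e)

-- R_ℓ(n) is the minimum of { d : n ∣ Φ_ℓ(d) }, or ∞ if there is none; in the
-- latter case R_ℓ(n) ≤ T is false.
R[_,_]≤_ : ℕ → ℕ → ℝ → Set
R[ ℓ , n ]≤ T = ∃[ d ] IsMinimum (λ e → + n ℤ∣.∣ Φ ℓ e) d × fromℕ d ≤ᴿ T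

ℙ : ℕ → Pred ℕ 0ℓ
ℙ ℓ p = Prime p × (∃[ d ] + p ℤ∣.∣ Φ ℓ d)

S² : ℕ → ℝ → Pred ℕ 0ℓ
S² ℓ T p = ℙ ℓ p × R[ ℓ , p ^ 2 ]≤ T

δ : ℕ → ℕ → ℕ
δ ℓ N = length (filter (λ a → N ℕ∣.∣? ℤ.∣ Φ ℓ a ∣) (upTo N))

localFactor : ℕ → (p : ℕ) .{{_ : ℕ.NonZero p}} → ℚ
localFactor ℓ p = 1ℚ ℚ.- (+ δ ℓ (p ^ 2) ℚ./ p ^ 2) {{ℕ.m^n≢0 p 2}}

-- ∏_{p ≤ N} (1 − δ(p²)/p²), over primes p.
partialProduct : ℕ → ℕ → ℚ
partialProduct ℓ zero    = 1ℚ
partialProduct ℓ (suc N) =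
  if does (prime? (suc N))
  then partialProduct ℓ N ℚ.* localFactor ℓ (suc N)
  else partialProduct ℓ N

-- Sieve by the squares of the primes p ≤ z.  By the Chinese remainder theorem
-- the sifted set is periodic with density exactly ∏_{p ≤ z} (1 − δ(p²)/p²).
-- For p > ℓ the roots of Φ_ℓ = X^{ℓ−1} + … + 1 modulo p² are determined by
-- their residues modulo p, so δ(p²) ≤ ℓ and p² ∣ Φ_ℓ(n) for at most
-- ℓ (X/p² + 1) of the n ≤ X; if it happens at all then p ∈ S²(ℓ, X).  Hence the
-- primes above z remove at most ℓ X/z + ℓ |S²(ℓ, X)| = ℓ X/z + o(X) values.  The
-- limit C is positive because Φ_ℓ(0) = 1 makes every factor positive and the
-- product over p > z is at least 1 − ℓ/z.
--
-- The integer part of a Cauchy real exists only up to double negation, which is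
-- enough because _≤ᴿ_ is stable.
module Submission where

open import Defs
open import Data.Bool using (true; false; if_then_else_)
open import Data.Empty using (⊥-elim)
open import Data.Integer as ℤ using (ℤ; +_; 0ℤ; 1ℤ; -1ℤ)
import Data.Integer.Divisibility.Signed as ℤ∣
import Data.Integer.Properties as ℤ
import Data.Integer.Tactic.RingSolver as ℤ-Ring
open import Data.List using (List; []; _∷_; _++_; [_]; filter; foldl; length; map; replicate; upTo; applyUpTo)
import Data.List.Properties as List
open import Data.List.Membership.Propositional using (_∈_)
import Data.List.Membership.Propositional.Properties as ∈
open import Data.List.Relation.Unary.All as All using (All; []; _∷_)
import Data.List.Relation.Unary.All.Properties as All
open import Data.List.Relation.Unary.AllPairs as AllPairs using (AllPairs; []; _∷_)
import Data.List.Relation.Unary.AllPairs.Properties as AllPairs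
open import Data.List.Relation.Unary.Any using (here; there)
open import Data.List.Relation.Unary.Unique.Propositional using (Unique)
import Data.List.Relation.Unary.Unique.Propositional.Properties as Unique
open import Data.Nat as ℕ using (ℕ; zero; suc; _+_; _*_; _∸_; _^_; _⊔_; _≤_; _<_; z≤n; s≤s; NonZero)
open import Data.Nat.Divisibility using (_∣_; _∣?_; divides)
import Data.Nat.Divisibility as ℕ
import Data.Nat.DivMod as ℕ
open import Data.Nat.Primality using (Prime; prime?; euclidsLemma; prime⇒nonZero; prime⇒nonTrivial; prime⇒irreducible; ¬prime[0]; ¬prime[1])
open import Data.Nat.Primality.Factorisation using (factorise)
import Data.Nat.Properties as ℕ
import Data.Nat.Tactic.RingSolver as ℕ-Ring
open import Data.Product using (∃-syntax; _×_; _,_; proj₁; proj₂)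
open import Data.Rational as ℚ using (ℚ; 0ℚ; 1ℚ; ½; positive)
import Data.Rational.Properties as ℚ
import Data.Rational.Solver as ℚ
import Data.Rational.Unnormalised as ℚᵘ
import Data.Rational.Unnormalised.Properties as ℚᵘ
open import Data.Sum using (_⊎_; inj₁; inj₂; [_,_]′)
open import Function using (_∘_; id; _⇔_; mk⇔; Equivalence)
open import Level using (0ℓ)
open import Relation.Binary.PropositionalEquality
  using (_≡_; _≢_; refl; sym; trans; cong; cong₂; subst; subst₂; module ≡-Reasoning)
open import Relation.Nullary using (¬_; Dec; yes; no; does; contradiction)
open import Relation.Nullary.Decidable using (¬?; _×-dec_)
open import Relation.Unary using (Pred; Decidable)

open ℚ.+-*-Solver using (solve; _:=_; _:+_; _:*_; _:-_; :-_; con)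

-- Roots of Φ_ℓ modulo p and p²

-- For n ≤ X, squarefreeness of Φ_ℓ(n) is the same as surviving the sieve up to any level b above
-- all these values; Φ_ℓ(n) > 0 makes such a b exist. Since b grows with X, every tail estimate must
-- be uniform in b. This is why 1/p² is replaced by 1/(p - 1) - 1/p and summed over all integers p:
-- the telescope from z to b never exceeds 1/(z + 1). The error is measured against ε C X, so an
-- explicit c > 0 below all partial products is needed before z is chosen. Modulo p and p² the work
-- is done with (X - 1) Φ_ℓ(X) = X^ℓ - 1, whose difference quotients are explicit, instead of with
-- the derivative of Φ_ℓ. Counts start at the argument 0, so that periods begin there; Φ_ℓ(0) = 1
-- then adds exactly one to the count of the theorem. The final comparison is made between
-- rationals, index by index: the n-th partial product stands for C and the n-th approximation for
-- X.

longDivision-unity : ∀ j →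
  longDivision (suc j) (1ℤ ∷ replicate j 0ℤ ++ [ -1ℤ ]) [ -1ℤ ] ≡ replicate (suc j) 1ℤ
longDivision-unity zero    = refl
-- Dividing by X - 1 turns the next coefficient 0 into 0 - 1 · (-1) = 1, so the dividend keeps its
-- shape with one zero fewer.
longDivision-unity (suc j) = cong (1ℤ ∷_) (longDivision-unity j)

properDivisors-prime : ∀ {ℓ} → Prime ℓ → properDivisors ℓ ≡ [ 1 ]
properDivisors-prime {zero} prime-ℓ = ⊥-elim (¬prime[0] prime-ℓ)
properDivisors-prime {suc zero} prime-ℓ = ⊥-elim (¬prime[1] prime-ℓ)
properDivisors-prime ℓ@{suc (suc m)} prime-ℓ = begin
  filter (_∣? ℓ) (0 ∷ 1 ∷ rest)  ≡⟨ List.filter-reject (_∣? ℓ) {0} {1 ∷ rest} (λ 0∣ℓ → contradiction (ℕ.0∣⇒≡0 0∣ℓ) λ ()) ⟩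
  filter (_∣? ℓ) (1 ∷ rest)      ≡⟨ List.filter-accept (_∣? ℓ) {1} {rest} (ℕ.1∣ ℓ) ⟩
  1 ∷ filter (_∣? ℓ) rest        ≡⟨ cong (1 ∷_) (List.filter-none (_∣? ℓ) (All.applyUpTo⁺₁ (suc ∘ suc) m none)) ⟩
  [ 1 ]                          ∎
  where
  open ≡-Reasoning
  rest = applyUpTo (suc ∘ suc) m
  none : ∀ {i} → i < m → ¬ (2 + i ∣ ℓ)
  none i<m d∣ℓ with prime⇒irreducible prime-ℓ d∣ℓ
  ... | inj₁ ()
  ... | inj₂ refl = ℕ.<-irrefl refl i<m

cyclotomic-prime : ∀ {ℓ} → Prime ℓ → cyclotomic ℓ ≡ replicate ℓ 1ℤ
cyclotomic-prime {zero} prime-ℓ = ⊥-elim (¬prime[0] prime-ℓ)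
cyclotomic-prime {suc zero} prime-ℓ = ⊥-elim (¬prime[1] prime-ℓ)
cyclotomic-prime ℓ@{suc (suc m)} prime-ℓ = begin
  foldl _÷_ (unityPolynomial ℓ) (map (cyclotomicWithin (suc m)) (properDivisors ℓ))
    ≡⟨ cong (λ ds → foldl _÷_ (unityPolynomial ℓ) (map (cyclotomicWithin (suc m)) ds)) (properDivisors-prime prime-ℓ) ⟩
  longDivision (length (replicate (suc m) 0ℤ ++ [ -1ℤ ])) (unityPolynomial ℓ) [ -1ℤ ]
    ≡⟨ cong (λ k → longDivision k (unityPolynomial ℓ) [ -1ℤ ]) length-unity ⟩
  longDivision ℓ (unityPolynomial ℓ) [ -1ℤ ]
    ≡⟨ longDivision-unity (suc m) ⟩
  replicate ℓ 1ℤ ∎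
  where
  open ≡-Reasoning
  length-unity : length (replicate (suc m) 0ℤ ++ [ -1ℤ ]) ≡ ℓ
  length-unity = trans (List.length-++ (replicate (suc m) 0ℤ))
    (trans (cong (_+ 1) (List.length-replicate (suc m))) (ℕ.+-comm (suc m) 1))

horner : ℤ → ℤ → ℤ → ℤ
horner x acc a = acc ℤ.* x ℤ.+ a

-- The accumulator is arbitrary so that the induction goes through. At `acc` = 0 this is (x - 1)(1 +
-- x + ... + xⁿ⁻¹) + 1 = xⁿ.
geometric-sum : ∀ x acc n →
  (x ℤ.- 1ℤ) ℤ.* foldl (horner x) acc (replicate n 1ℤ) ℤ.+ 1ℤ
    ≡ x ℤ.^ n ℤ.* ((x ℤ.- 1ℤ) ℤ.* acc ℤ.+ 1ℤ)
geometric-sum x acc zero    = sym (ℤ.*-identityˡ _)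
geometric-sum x acc (suc n) =
  trans (geometric-sum x (acc ℤ.* x ℤ.+ 1ℤ) n) (step x acc (x ℤ.^ n))
  where
  step : ∀ x acc y → y ℤ.* ((x ℤ.- 1ℤ) ℤ.* (acc ℤ.* x ℤ.+ 1ℤ) ℤ.+ 1ℤ)
    ≡ (x ℤ.* y) ℤ.* ((x ℤ.- 1ℤ) ℤ.* acc ℤ.+ 1ℤ)
  step = ℤ-Ring.solve-∀

-- Ensures that Φ_ℓ never takes the value 0, so that p² ∣ Φ_ℓ(n) bounds p.
ones-positive : ∀ n acc m → ∃[ v ] foldl (horner (+ n)) (+ suc acc) (replicate m 1ℤ) ≡ + suc v
ones-positive n acc zero    = acc , refl
ones-positive n acc (suc m)
  rewrite sym (ℤ.pos-* (suc acc) n) | ℕ.+-comm (suc acc * n) 1 = ones-positive n (suc acc * n) m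

-- Synthetic division: the Horner values of f at a are the coefficients of the
-- quotient of f by x − a.
quotient-coefficients : ℤ → ℤ → List ℤ → List ℤ
quotient-coefficients a v []       = []
quotient-coefficients a v (c ∷ cs) = v ∷ quotient-coefficients a (v ℤ.* a ℤ.+ c) cs

length-quotient : ∀ a v cs → length (quotient-coefficients a v cs) ≡ length cs
length-quotient a v []       = refl
length-quotient a v (c ∷ cs) = cong suc (length-quotient a (v ℤ.* a ℤ.+ c) cs)

synthetic-division : ∀ x a w v cs →
  foldl (horner x) ((x ℤ.- a) ℤ.* w ℤ.+ v) cs
    ≡ (x ℤ.- a) ℤ.* foldl (horner x) w (quotient-coefficients a v cs) ℤ.+ foldl (horner a) v cs
synthetic-division x a w v []       = refl
synthetic-division x a w v (c ∷ cs) = trans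
  (cong (λ u → foldl (horner x) u cs) (step x a w v c))
  (synthetic-division x a (w ℤ.* x ℤ.+ v) (v ℤ.* a ℤ.+ c) cs)
  where
  step : ∀ x a w v c → ((x ℤ.- a) ℤ.* w ℤ.+ v) ℤ.* x ℤ.+ c
    ≡ (x ℤ.- a) ℤ.* (w ℤ.* x ℤ.+ v) ℤ.+ (v ℤ.* a ℤ.+ c)
  step = ℤ-Ring.solve-∀

factor-theorem : ∀ x a v cs → foldl (horner x) v cs
  ≡ (x ℤ.- a) ℤ.* foldl (horner x) 0ℤ (quotient-coefficients a v cs) ℤ.+ foldl (horner a) v cs
factor-theorem x a v cs = trans (cong (λ u → foldl (horner x) u cs) (pad x a v)) (synthetic-division x a 0ℤ v cs)
  where
  pad : ∀ x a v → v ≡ (x ℤ.- a) ℤ.* 0ℤ ℤ.+ v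
  pad = ℤ-Ring.solve-∀

euclidℤ : ∀ {p} → Prime p → ∀ x y → + p ℤ∣.∣ x ℤ.* y → + p ℤ∣.∣ x ⊎ + p ℤ∣.∣ y
euclidℤ {p} prime-p x y p∣xy
  with euclidsLemma ℤ.∣ x ∣ ℤ.∣ y ∣ prime-p (subst (p ∣_) (ℤ.abs-* x y) (ℤ∣.∣⇒∣ᵤ p∣xy))
... | inj₁ p∣x = inj₁ (ℤ∣.∣ᵤ⇒∣ p∣x)
... | inj₂ p∣y = inj₂ (ℤ∣.∣ᵤ⇒∣ p∣y)

prime∤1 : ∀ {p} → Prime p → ¬ (p ∣ 1)
prime∤1 {p} prime-p p∣1 = ℕ.nonTrivial⇒≢1 ⦃ prime⇒nonTrivial prime-p ⦄ (ℕ.∣1⇒≡1 p∣1)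

congruent-below : ∀ {m a b} → a < m → b < m → + m ℤ∣.∣ + a ℤ.- + b → a ≡ b
congruent-below {m} {a} {b} a<m b<m m∣a-b with ℤ.∣ + a ℤ.- + b ∣ in eq
  | ℤ∣.∣⇒∣ᵤ m∣a-b
... | zero  | _  = ℤ.+-injective (ℤ.i-j≡0⇒i≡j (+ a) (+ b) (ℤ.∣i∣≡0⇒i≡0 eq))
... | suc k | d  = contradiction (ℕ.∣⇒≤ d) (ℕ.<⇒≱ (begin-strict
  suc k                ≡⟨ eq ⟨
  ℤ.∣ + a ℤ.- + b ∣    ≡⟨ cong ℤ.∣_∣ (ℤ.m-n≡m⊖n a b) ⟩
  ℤ.∣ a ℤ.⊖ b ∣        ≤⟨ ℤ.∣m⊝n∣≤m⊔n a b ⟩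
  a ⊔ b                <⟨ ℕ.⊔-lub a<m b<m ⟩
  m                    ∎))
  where open ℕ.≤-Reasoning

-- A Horner scheme started at 1 evaluates a monic polynomial. Its quotient by x - a is monic of one
-- degree less and, p being prime, still vanishes modulo p at every root incongruent to a. In degree
-- 0 the polynomial is 1, which has no roots.
lagrange : ∀ {p} → Prime p → ∀ cs xs →
  AllPairs (λ x y → ¬ (+ p ℤ∣.∣ y ℤ.- x)) xs →
  All (λ x → + p ℤ∣.∣ foldl (horner x) 1ℤ cs) xs →
  length xs ≤ length cs
lagrange prime-p cs       []       _                   _               = z≤n
lagrange prime-p []       (x ∷ xs) _                   (p∣1 ∷ _)       =
  ⊥-elim (prime∤1 prime-p (ℤ∣.∣⇒∣ᵤ p∣1))
lagrange {p} prime-p (c ∷ cs) (a ∷ xs) (a≢xs ∷ distinct) (p∣fa ∷ p∣fxs) =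
  s≤s (subst (length xs ≤_) (length-quotient a (1ℤ ℤ.* a ℤ.+ c) cs)
    (lagrange prime-p quotient xs distinct (All.zipWith root (a≢xs , p∣fxs))))
  where
  quotient = quotient-coefficients a (1ℤ ℤ.* a ℤ.+ c) cs
  root : ∀ {x} → (¬ (+ p ℤ∣.∣ x ℤ.- a)) × (+ p ℤ∣.∣ foldl (horner x) 1ℤ (c ∷ cs)) →
    + p ℤ∣.∣ foldl (horner x) 1ℤ quotient
  root {x} (p∤x-a , p∣fx) = [ ⊥-elim ∘ p∤x-a , id ]′ (euclidℤ prime-p (x ℤ.- a) q p∣product)
    where
    q f : ℤ
    q = foldl (horner x) 1ℤ quotient
    f = foldl (horner a) 1ℤ (c ∷ cs)
    p∣product : + p ℤ∣.∣ (x ℤ.- a) ℤ.* q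
    p∣product = ℤ∣.∣m+n∣n⇒∣m {+ p} {(x ℤ.- a) ℤ.* q} {f}
      (subst (+ p ℤ∣.∣_) (factor-theorem x a 1ℤ (c ∷ cs)) p∣fx) p∣fa

powerQuotient : ℤ → ℤ → ℕ → ℤ
powerQuotient a b zero    = 0ℤ
powerQuotient a b (suc n) = a ℤ.* powerQuotient a b n ℤ.+ b ℤ.^ n

power-difference : ∀ a b n → (a ℤ.- b) ℤ.* powerQuotient a b n ≡ a ℤ.^ n ℤ.- b ℤ.^ n
power-difference a b zero    = ℤ.*-zeroʳ (a ℤ.- b)
power-difference a b (suc n) = begin
  (a ℤ.- b) ℤ.* (a ℤ.* h ℤ.+ b ℤ.^ n)                   ≡⟨ expand a b h (b ℤ.^ n) ⟩
  a ℤ.* ((a ℤ.- b) ℤ.* h) ℤ.+ (a ℤ.- b) ℤ.* b ℤ.^ n     ≡⟨ cong (λ t → a ℤ.* t ℤ.+ (a ℤ.- b) ℤ.* b ℤ.^ n) (power-difference a b n) ⟩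
  a ℤ.* (a ℤ.^ n ℤ.- b ℤ.^ n) ℤ.+ (a ℤ.- b) ℤ.* b ℤ.^ n ≡⟨ collect a b (a ℤ.^ n) (b ℤ.^ n) ⟩
  a ℤ.* a ℤ.^ n ℤ.- b ℤ.* b ℤ.^ n                       ∎
  where
  open ≡-Reasoning
  h = powerQuotient a b n
  expand : ∀ a b h y → (a ℤ.- b) ℤ.* (a ℤ.* h ℤ.+ y) ≡ a ℤ.* ((a ℤ.- b) ℤ.* h) ℤ.+ (a ℤ.- b) ℤ.* y
  expand = ℤ-Ring.solve-∀
  collect : ∀ a b x y → a ℤ.* (x ℤ.- y) ℤ.+ (a ℤ.- b) ℤ.* y ≡ a ℤ.* x ℤ.- b ℤ.* y
  collect = ℤ-Ring.solve-∀

∣-power-difference : ∀ {d} a b n → d ℤ∣.∣ a ℤ.- b → d ℤ∣.∣ a ℤ.^ n ℤ.- b ℤ.^ n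
∣-power-difference {d} a b n d∣a-b =
  subst (d ℤ∣.∣_) (power-difference a b n) (ℤ∣.∣m⇒∣m*n (powerQuotient a b n) d∣a-b)

-- If a ≡ b then (aⁿ − bⁿ)/(a − b) ≡ n aⁿ⁻¹, the derivative.
powerQuotient-congruence : ∀ {d} a b n → d ℤ∣.∣ a ℤ.- b →
  d ℤ∣.∣ a ℤ.* powerQuotient a b n ℤ.- + n ℤ.* a ℤ.^ n
powerQuotient-congruence {d} a b zero    d∣a-b = subst (d ℤ∣.∣_) (vanish a) (ℤ∣.divides 0ℤ refl)
  where
  vanish : ∀ a → 0ℤ ≡ a ℤ.* 0ℤ ℤ.- 0ℤ ℤ.* 1ℤ
  vanish = ℤ-Ring.solve-∀
powerQuotient-congruence {d} a b (suc n) d∣a-b = subst (d ℤ∣.∣_) regroup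
  (ℤ∣.∣m∣n⇒∣m-n (ℤ∣.∣n⇒∣m*n a (powerQuotient-congruence a b n d∣a-b)) (ℤ∣.∣n⇒∣m*n a (∣-power-difference a b n d∣a-b)))
  where
  h = powerQuotient a b n
  identity : ∀ a h x y k → a ℤ.* (a ℤ.* h ℤ.- k ℤ.* x) ℤ.- a ℤ.* (x ℤ.- y)
    ≡ a ℤ.* (a ℤ.* h ℤ.+ y) ℤ.- (1ℤ ℤ.+ k) ℤ.* (a ℤ.* x)
  identity = ℤ-Ring.solve-∀
  regroup : a ℤ.* (a ℤ.* h ℤ.- + n ℤ.* a ℤ.^ n) ℤ.- a ℤ.* (a ℤ.^ n ℤ.- b ℤ.^ n)
    ≡ a ℤ.* (a ℤ.* h ℤ.+ b ℤ.^ n) ℤ.- + suc n ℤ.* a ℤ.^ suc n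
  regroup = identity a h (a ℤ.^ n) (b ℤ.^ n) (+ n)

prime∣^⇒∣ : ∀ {p} → Prime p → ∀ a n → + p ℤ∣.∣ a ℤ.^ n → + p ℤ∣.∣ a
prime∣^⇒∣ prime-p a zero    p∣1 = ⊥-elim (prime∤1 prime-p (ℤ∣.∣⇒∣ᵤ p∣1))
prime∣^⇒∣ prime-p a (suc n) p∣a*aⁿ with euclidℤ prime-p a (a ℤ.^ n) p∣a*aⁿ
... | inj₁ p∣a  = p∣a
... | inj₂ p∣aⁿ = prime∣^⇒∣ prime-p a n p∣aⁿ

p²≡p*p : ∀ p → p ^ 2 ≡ p * p
p²≡p*p p = cong (p *_) (ℕ.*-identityʳ p)

-- Euclid's lemma removes the two factors p one at a time. Used twice: with h a difference quotient
-- to lift congruences from p to p², and with h the modulus of the smaller primes for the Chinese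
-- remainder theorem.
p²-cancel : ∀ {p} → Prime p → ∀ x h → ¬ (p ∣ h) → p ^ 2 ∣ x * h → p ^ 2 ∣ x
p²-cancel {p} prime-p x h p∤h p²∣xh
  with euclidsLemma x h prime-p (ℕ.∣-trans (ℕ.m∣m*n (p ^ 1)) p²∣xh)
... | inj₂ p∣h = contradiction p∣h p∤h
... | inj₁ (divides y refl)
  with euclidsLemma y h prime-p (ℕ.*-cancelʳ-∣ p ⦃ prime⇒nonZero prime-p ⦄
         (subst₂ _∣_ (p²≡p*p p) (regroup y p h) p²∣xh))
  where
  regroup : ∀ y p h → y * p * h ≡ y * h * p
  regroup = ℕ-Ring.solve-∀
... | inj₂ p∣h = contradiction p∣h p∤h
... | inj₁ (divides z refl) = divides z (trans (ℕ.*-assoc z p p) (cong (z *_) (sym (p²≡p*p p))))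

φ : ℕ → ℕ → ℕ
φ ℓ n = ℤ.∣ Φ ℓ n ∣

module _ (ℓ : ℕ) (prime-ℓ : Prime ℓ) where

  Φ≡ones : ∀ n → Φ ℓ n ≡ replicate ℓ 1ℤ ⟨ + n ⟩
  Φ≡ones n = cong (_⟨ + n ⟩) (cyclotomic-prime prime-ℓ)

  Φ≡horner : ∃[ m ] ℓ ≡ suc m × (∀ n → Φ ℓ n ≡ foldl (horner (+ n)) 1ℤ (replicate m 1ℤ))
  Φ≡horner = ℕ.pred ℓ , sym ℓ-suc , λ n → trans (Φ≡ones n) (cong (λ k → replicate k 1ℤ ⟨ + n ⟩) (sym ℓ-suc))
    where
    ℓ-suc : suc (ℕ.pred ℓ) ≡ ℓ
    ℓ-suc = ℕ.suc-pred ℓ ⦃ prime⇒nonZero prime-ℓ ⦄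

  Φ-positive : ∀ n → ∃[ v ] Φ ℓ n ≡ + suc v
  Φ-positive n with Φ≡horner
  ... | m , _ , eq with ones-positive n 0 m
  ... | v , eq′ = v , trans (eq n) eq′

  φ≢0 : ∀ n → φ ℓ n ≢ 0
  φ≢0 n φn≡0 with Φ-positive n
  ... | v , eq with trans (sym (cong ℤ.∣_∣ eq)) φn≡0
  ... | ()

  Φ-power : ∀ n → (+ n ℤ.- 1ℤ) ℤ.* Φ ℓ n ℤ.+ 1ℤ ≡ (+ n) ℤ.^ ℓ
  Φ-power n = begin
    (+ n ℤ.- 1ℤ) ℤ.* Φ ℓ n ℤ.+ 1ℤ                       ≡⟨ cong (λ v → (+ n ℤ.- 1ℤ) ℤ.* v ℤ.+ 1ℤ) (Φ≡ones n) ⟩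
    (+ n ℤ.- 1ℤ) ℤ.* (replicate ℓ 1ℤ ⟨ + n ⟩) ℤ.+ 1ℤ    ≡⟨ geometric-sum (+ n) 0ℤ ℓ ⟩
    (+ n) ℤ.^ ℓ ℤ.* ((+ n ℤ.- 1ℤ) ℤ.* 0ℤ ℤ.+ 1ℤ)          ≡⟨ simplify (+ n) ((+ n) ℤ.^ ℓ) ⟩
    (+ n) ℤ.^ ℓ                                           ∎
    where
    open ≡-Reasoning
    simplify : ∀ x y → y ℤ.* ((x ℤ.- 1ℤ) ℤ.* 0ℤ ℤ.+ 1ℤ) ≡ y
    simplify = ℤ-Ring.solve-∀

  -- In (n - 1) Φ_ℓ(n) + 1 = n^ℓ a common divisor of Φ_ℓ(n) and n divides two terms, hence also 1.
  -- For n = 0 it says that 0 is never a root.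
  root-coprime : ∀ {d} n → d ∣ φ ℓ n → d ∣ n → d ∣ 1
  root-coprime {d} n d∣φn d∣n = ℤ∣.∣⇒∣ᵤ {+ d} {1ℤ} (ℤ∣.∣m+n∣m⇒∣n {m = (+ n ℤ.- 1ℤ) ℤ.* Φ ℓ n}
    (subst (+ d ℤ∣.∣_) (sym (Φ-power n)) (d∣power ℓ ⦃ prime⇒nonZero prime-ℓ ⦄))
    (ℤ∣.∣n⇒∣m*n (+ n ℤ.- 1ℤ) (ℤ∣.∣ᵤ⇒∣ d∣φn)))
    where
    d∣power : ∀ k .⦃ _ : NonZero k ⦄ → + d ℤ∣.∣ (+ n) ℤ.^ k
    d∣power (suc k) = ℤ∣.∣m⇒∣m*n {m = + n} ((+ n) ℤ.^ k) (ℤ∣.∣ᵤ⇒∣ d∣n)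

  φ-shift : ∀ {d} m n → + d ℤ∣.∣ + n ℤ.- + m → d ∣ φ ℓ m → d ∣ φ ℓ n
  φ-shift {d} m n d∣n-m d∣φm = ℤ∣.∣⇒∣ᵤ (subst (+ d ℤ∣.∣_)
    (sym (trans (Φ≡ones n) (trans (factor-theorem (+ n) (+ m) 0ℤ (replicate ℓ 1ℤ))
      (cong (ℤ._+_ ((+ n ℤ.- + m) ℤ.* q)) (sym (Φ≡ones m))))))
    (ℤ∣.∣m∣n⇒∣m+n {m = (+ n ℤ.- + m) ℤ.* q} (ℤ∣.∣m⇒∣m*n q d∣n-m) (ℤ∣.∣ᵤ⇒∣ d∣φm)))
    where q = foldl (horner (+ n)) 0ℤ (quotient-coefficients (+ m) 0ℤ (replicate ℓ 1ℤ))

  -- Subtracting (X - 1) Φ_ℓ(X) = X^ℓ - 1 at a and b gives p² ∣ (a - b) h with h = (a^ℓ - b^ℓ)/(a -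
  -- b). Modulo p, a h ≡ ℓ a^ℓ; since p divides neither ℓ < p nor the root a, it does not divide h.
  hensel-uniqueness : ∀ {p} → Prime p → ℓ < p → ∀ a b → p ^ 2 ∣ φ ℓ a → p ^ 2 ∣ φ ℓ b →
    + p ℤ∣.∣ + a ℤ.- + b → + (p ^ 2) ℤ∣.∣ + a ℤ.- + b
  hensel-uniqueness {p} prime-p ℓ<p a b p²∣φa p²∣φb p∣a-b =
    ℤ∣.∣ᵤ⇒∣ (p²-cancel prime-p ℤ.∣ + a ℤ.- + b ∣ ℤ.∣ h ∣ p∤h
      (subst (p ^ 2 ∣_) (ℤ.abs-* (+ a ℤ.- + b) h) (ℤ∣.∣⇒∣ᵤ p²∣product)))
    where
    h = powerQuotient (+ a) (+ b) ℓ
    difference : ∀ x y u v → x ℤ.* u ℤ.- y ℤ.* v ≡ (x ℤ.* u ℤ.+ 1ℤ) ℤ.- (y ℤ.* v ℤ.+ 1ℤ)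
    difference = ℤ-Ring.solve-∀
    p²∣product : + (p ^ 2) ℤ∣.∣ (+ a ℤ.- + b) ℤ.* h
    p²∣product = subst (+ (p ^ 2) ℤ∣.∣_)
      (trans (difference (+ a ℤ.- 1ℤ) (+ b ℤ.- 1ℤ) (Φ ℓ a) (Φ ℓ b))
        (trans (cong₂ ℤ._-_ (Φ-power a) (Φ-power b)) (sym (power-difference (+ a) (+ b) ℓ))))
      (ℤ∣.∣m∣n⇒∣m-n (ℤ∣.∣n⇒∣m*n (+ a ℤ.- 1ℤ) (ℤ∣.∣ᵤ⇒∣ p²∣φa)) (ℤ∣.∣n⇒∣m*n (+ b ℤ.- 1ℤ) (ℤ∣.∣ᵤ⇒∣ p²∣φb)))
    p∣φa : p ∣ φ ℓ a
    p∣φa = ℕ.∣-trans (ℕ.m∣m*n (p ^ 1)) p²∣φa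
    p∤h : ¬ (p ∣ ℤ.∣ h ∣)
    p∤h p∣h = [ p∤ℓ , p∤aℓ ]′ (euclidℤ prime-p (+ ℓ) aℓ p∣ℓaℓ)
      where
      aℓ = (+ a) ℤ.^ ℓ
      p∣ℓaℓ : + p ℤ∣.∣ + ℓ ℤ.* aℓ
      p∣ℓaℓ = subst (+ p ℤ∣.∣_) (cancel (+ a ℤ.* h) (+ ℓ ℤ.* aℓ))
        (ℤ∣.∣m∣n⇒∣m-n {+ p} {+ a ℤ.* h} {+ a ℤ.* h ℤ.- + ℓ ℤ.* aℓ}
          (ℤ∣.∣n⇒∣m*n (+ a) {h} (ℤ∣.∣ᵤ⇒∣ p∣h)) (powerQuotient-congruence (+ a) (+ b) ℓ p∣a-b))
        where
        cancel : ∀ x y → x ℤ.- (x ℤ.- y) ≡ y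
        cancel = ℤ-Ring.solve-∀
      p∤ℓ : ¬ (+ p ℤ∣.∣ + ℓ)
      p∤ℓ p∣ℓ = ℕ.<⇒≱ ℓ<p (ℕ.∣⇒≤ ⦃ prime⇒nonZero prime-ℓ ⦄ (ℤ∣.∣⇒∣ᵤ p∣ℓ))
      p∤aℓ : ¬ (+ p ℤ∣.∣ aℓ)
      p∤aℓ p∣aℓ = prime∤1 prime-p (root-coprime a p∣φa (ℤ∣.∣⇒∣ᵤ (prime∣^⇒∣ prime-p (+ a) ℓ p∣aℓ)))

  root? : ∀ d → Decidable (λ a → d ∣ φ ℓ a)
  root? d a = d ∣? φ ℓ a

  -- Two roots below p² that agree modulo p agree modulo p², hence are equal. So the roots are
  -- distinct modulo p and Lagrange applies, with degree ℓ - 1; the bound is relaxed to ℓ.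
  δ≤ℓ : ∀ {p} → Prime p → ℓ < p → δ ℓ (p ^ 2) ≤ ℓ
  δ≤ℓ {p} prime-p ℓ<p with Φ≡horner
  ... | m , ℓ≡1+m , Φ≡ = begin
    length roots               ≡⟨ List.length-map +_ roots ⟨
    length (map +_ roots)      ≤⟨ lagrange prime-p (replicate m 1ℤ) (map +_ roots)
                                    (AllPairs.map⁺ (distinct (Unique.filter⁺ (root? (p ^ 2)) (Unique.upTo⁺ (p ^ 2))) roots-spec))
                                    (All.map⁺ (All.map (λ {a} r → subst (+ p ℤ∣.∣_) (Φ≡ a) (ℤ∣.∣ᵤ⇒∣ (ℕ.∣-trans (ℕ.m∣m*n (p ^ 1)) (proj₂ r)))) roots-spec)) ⟩
    length (replicate m 1ℤ)    ≡⟨ List.length-replicate m ⟩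
    m                          ≤⟨ ℕ.n≤1+n m ⟩
    suc m                      ≡⟨ ℓ≡1+m ⟨
    ℓ                          ∎
    where
    open ℕ.≤-Reasoning
    roots = filter (root? (p ^ 2)) (upTo (p ^ 2))
    roots-spec : All (λ a → a < p ^ 2 × p ^ 2 ∣ φ ℓ a) roots
    roots-spec = All.tabulate λ a∈ → let a∈upTo , r = ∈.∈-filter⁻ (root? (p ^ 2)) a∈ in ∈.∈-upTo⁻ a∈upTo , r
    distinct : ∀ {xs} → Unique xs → All (λ a → a < p ^ 2 × p ^ 2 ∣ φ ℓ a) xs →
      AllPairs (λ x y → ¬ (+ p ℤ∣.∣ + y ℤ.- + x)) xs
    distinct []        []       = []
    distinct {x ∷ _} (x≢ ∷ u) ((x< , rx) ∷ rs) =
      All.zipWith (λ {y} (x≢y , y< , ry) p∣y-x → x≢y (sym (congruent-below y< x< (hensel-uniqueness prime-p ℓ<p y x ry rx p∣y-x))))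
        (x≢ , rs) ∷ distinct u rs

-- Counting and the Chinese remainder theorem

if-yes : ∀ {P A : Set} (P? : Dec P) {x y : A} → P → (if does P? then x else y) ≡ x
if-yes (yes _) _ = refl
if-yes (no ¬p) p = contradiction p ¬p

if-no : ∀ {P A : Set} (P? : Dec P) {x y : A} → ¬ P → (if does P? then x else y) ≡ y
if-no (yes p) ¬p = contradiction p ¬p
if-no (no _)  _  = refl

𝟙 : ∀ {P : Set} → Dec P → ℕ
𝟙 P? = if does P? then 1 else 0

𝟙-yes : ∀ {P : Set} (P? : Dec P) → P → 𝟙 P? ≡ 1
𝟙-yes P? = if-yes P?

𝟙-no : ∀ {P : Set} (P? : Dec P) → ¬ P → 𝟙 P? ≡ 0
𝟙-no P? = if-no P?

𝟙≤1 : ∀ {P : Set} (P? : Dec P) → 𝟙 P? ≤ 1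
𝟙≤1 (yes _) = ℕ.≤-refl
𝟙≤1 (no _)  = z≤n

𝟙-mono : ∀ {P Q : Set} (P? : Dec P) (Q? : Dec Q) → (P → Q) → 𝟙 P? ≤ 𝟙 Q?
𝟙-mono (yes p) Q? f = ℕ.≤-reflexive (sym (𝟙-yes Q? (f p)))
𝟙-mono (no _)  Q? f = z≤n

𝟙-cong : ∀ {P Q : Set} (P? : Dec P) (Q? : Dec Q) → (P → Q) → (Q → P) → 𝟙 P? ≡ 𝟙 Q?
𝟙-cong P? Q? f g = ℕ.≤-antisym (𝟙-mono P? Q? f) (𝟙-mono Q? P? g)

𝟙-× : ∀ {P Q : Set} (P? : Dec P) (Q? : Dec Q) → 𝟙 (P? ×-dec Q?) ≡ 𝟙 P? * 𝟙 Q?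
𝟙-× (yes _) (yes _) = refl
𝟙-× (yes _) (no _)  = refl
𝟙-× (no _)  _       = refl

𝟙+𝟙¬ : ∀ {P : Set} (P? : Dec P) → 𝟙 P? + 𝟙 (¬? P?) ≡ 1
𝟙+𝟙¬ (yes _) = refl
𝟙+𝟙¬ (no _)  = refl

∑ : (ℕ → ℕ) → ℕ → ℕ
∑ f zero    = 0
∑ f (suc n) = ∑ f n + f n

∑-cong : ∀ {f g} → (∀ n → f n ≡ g n) → ∀ N → ∑ f N ≡ ∑ g N
∑-cong f≡g zero    = refl
∑-cong f≡g (suc N) = cong₂ _+_ (∑-cong f≡g N) (f≡g N)

∑-mono : ∀ {f g} → (∀ n → f n ≤ g n) → ∀ N → ∑ f N ≤ ∑ g N
∑-mono f≤g zero    = z≤n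
∑-mono f≤g (suc N) = ℕ.+-mono-≤ (∑-mono f≤g N) (f≤g N)

∑-monoʳ : ∀ f {m n} → m ≤ n → ∑ f m ≤ ∑ f n
∑-monoʳ f {n = zero}  z≤n = z≤n
∑-monoʳ f {n = suc n} m≤1+n with ℕ.m≤n⇒m<n∨m≡n m≤1+n
... | inj₁ (s≤s m≤n) = ℕ.≤-trans (∑-monoʳ f m≤n) (ℕ.m≤m+n _ (f n))
... | inj₂ refl      = ℕ.≤-refl

∑-zero : ∀ {f} N → (∀ {n} → n < N → f n ≡ 0) → ∑ f N ≡ 0
∑-zero zero    f≡0 = refl
∑-zero (suc N) f≡0 = cong₂ _+_ (∑-zero N (f≡0 ∘ ℕ.m<n⇒m<1+n)) (f≡0 ℕ.≤-refl)

∑-one : ∀ N → ∑ (λ _ → 1) N ≡ N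
∑-one zero    = refl
∑-one (suc N) = trans (cong (_+ 1) (∑-one N)) (ℕ.+-comm N 1)

∑-+ : ∀ f g N → ∑ (λ n → f n + g n) N ≡ ∑ f N + ∑ g N
∑-+ f g zero    = refl
∑-+ f g (suc N) = trans (cong (_+ (f N + g N)) (∑-+ f g N)) (interchange (∑ f N) (∑ g N) (f N) (g N))
  where
  interchange : ∀ a b c d → (a + b) + (c + d) ≡ (a + c) + (b + d)
  interchange = ℕ-Ring.solve-∀

∑-*ˡ : ∀ c f N → ∑ (λ n → c * f n) N ≡ c * ∑ f N
∑-*ˡ c f zero    = sym (ℕ.*-zeroʳ c)
∑-*ˡ c f (suc N) = trans (cong (_+ c * f N) (∑-*ˡ c f N)) (sym (ℕ.*-distribˡ-+ c (∑ f N) (f N)))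

∑-*ʳ : ∀ c f N → ∑ (λ n → f n * c) N ≡ ∑ f N * c
∑-*ʳ c f N = trans (∑-cong (λ n → ℕ.*-comm (f n) c) N) (trans (∑-*ˡ c f N) (ℕ.*-comm c _))

∑-split : ∀ f m n → ∑ f (m + n) ≡ ∑ f m + ∑ (λ i → f (m + i)) n
∑-split f m zero    = trans (cong (∑ f) (ℕ.+-identityʳ m)) (sym (ℕ.+-identityʳ _))
∑-split f m (suc n) = trans (cong (∑ f) (ℕ.+-suc m n))
  (trans (cong (_+ f (m + n)) (∑-split f m n)) (ℕ.+-assoc (∑ f m) _ _))

∑-swap : ∀ (h : ℕ → ℕ → ℕ) m n → ∑ (λ i → ∑ (h i) n) m ≡ ∑ (λ j → ∑ (λ i → h i j) m) n
∑-swap h zero    n = sym (∑-zero n λ _ → refl)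
∑-swap h (suc m) n = trans (cong (_+ ∑ (h m) n) (∑-swap h m n)) (sym (∑-+ (λ j → ∑ (λ i → h i j) m) (h m) n))

∑-blocks : ∀ f m M → ∑ f (m * M) ≡ ∑ (λ j → ∑ (λ r → f (j * M + r)) M) m
∑-blocks f zero    M = refl
∑-blocks f (suc m) M = trans (cong (∑ f) (ℕ.+-comm M (m * M)))
  (trans (∑-split f (m * M) M) (cong (_+ ∑ (λ r → f (m * M + r)) M) (∑-blocks f m M)))

Periodic : ℕ → (ℕ → ℕ) → Set
Periodic M f = ∀ n → f (M + n) ≡ f n

periodic-multiple : ∀ {M f} → Periodic M f → ∀ j r → f (j * M + r) ≡ f r
periodic-multiple         per zero    r = refl
periodic-multiple {M} {f} per (suc j) r =
  trans (cong f (ℕ.+-assoc M (j * M) r)) (trans (per (j * M + r)) (periodic-multiple per j r))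

∑-periodic : ∀ {M f} → Periodic M f → ∀ q r → ∑ f (q * M + r) ≡ q * ∑ f M + ∑ f r
∑-periodic {M} {f} per q r = begin
  ∑ f (q * M + r)                                             ≡⟨ ∑-split f (q * M) r ⟩
  ∑ f (q * M) + ∑ (λ i → f (q * M + i)) r                     ≡⟨ cong₂ _+_ (∑-blocks f q M) (∑-cong (periodic-multiple per q) r) ⟩
  -- The factor 1 brings the inner sum, constant in j, into the shape 1 · c from which `∑-*ʳ`
  -- extracts c.
  ∑ (λ j → ∑ (λ i → f (j * M + i)) M) q + ∑ f r               ≡⟨ cong (_+ ∑ f r) (∑-cong (λ j → ∑-cong (λ i → trans (periodic-multiple per j i) (sym (ℕ.*-identityˡ (f i)))) M) q) ⟩
  ∑ (λ j → ∑ (λ i → 1 * f i) M) q + ∑ f r                     ≡⟨ cong (_+ ∑ f r) (∑-cong (λ j → ∑-*ˡ 1 f M) q) ⟩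
  ∑ (λ j → 1 * ∑ f M) q + ∑ f r                               ≡⟨ cong (_+ ∑ f r) (trans (∑-*ʳ (∑ f M) (λ _ → 1) q) (cong (_* ∑ f M) (∑-one q))) ⟩
  q * ∑ f M + ∑ f r                                           ∎
  where open ≡-Reasoning

count : ∀ {P : Pred ℕ 0ℓ} → Decidable P → ℕ → ℕ
count P? N = length (filter P? (upTo N))

-- Lists carry δ, cardinalities and the pigeonhole argument; sums carry the algebra. This is the
-- passage between them.
count≡∑ : ∀ {P : Pred ℕ 0ℓ} (P? : Decidable P) N → count P? N ≡ ∑ (𝟙 ∘ P?) N
count≡∑ P? zero    = refl
count≡∑ P? (suc N) = begin
  length (filter P? (upTo (suc N)))                       ≡⟨ cong (length ∘ filter P?) (List.upTo-∷ʳ N) ⟨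
  length (filter P? (upTo N ++ [ N ]))                    ≡⟨ cong length (List.filter-++ P? (upTo N) [ N ]) ⟩
  length (filter P? (upTo N) ++ filter P? [ N ])          ≡⟨ List.length-++ (filter P? (upTo N)) ⟩
  count P? N + length (filter P? [ N ])                   ≡⟨ cong₂ _+_ (count≡∑ P? N) last ⟩
  ∑ (𝟙 ∘ P?) N + 𝟙 (P? N)                                 ∎
  where
  open ≡-Reasoning
  last : length (filter P? [ N ]) ≡ 𝟙 (P? N)
  last with does (P? N)
  ... | true  = refl
  ... | false = refl

∈-count⁺ : ∀ {P : Pred ℕ 0ℓ} (P? : Decidable P) {N n} → n < N → P n → n ∈ filter P? (upTo N)
∈-count⁺ P? n<N = ∈.∈-filter⁺ P? (∈.∈-upTo⁺ n<N)

∈-count⁻ : ∀ {P : Pred ℕ 0ℓ} (P? : Decidable P) {N n} → n ∈ filter P? (upTo N) → n < N × P n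
∈-count⁻ P? n∈ = let n∈upTo , Pn = ∈.∈-filter⁻ P? n∈ in ∈.∈-upTo⁻ n∈upTo , Pn

unique-count : ∀ {P : Pred ℕ 0ℓ} (P? : Decidable P) N → Unique (filter P? (upTo N))
unique-count P? N = Unique.filter⁺ P? (Unique.upTo⁺ N)

-- One occurrence of σ x is taken out of `ys`; by injectivity no later element of `xs` has that
-- image, so the rest still maps into what remains.
pigeonhole : ∀ {A : Set} (σ : A → ℕ) xs ys → Unique xs →
  (∀ {x} → x ∈ xs → σ x ∈ ys) →
  (∀ {x y} → x ∈ xs → y ∈ xs → σ x ≡ σ y → x ≡ y) →
  length xs ≤ length ys
pigeonhole σ []       ys _            into inj = z≤n
pigeonhole σ (x ∷ xs) ys (x∉xs ∷ uxs) into inj with ∈.∈-∃++ (into (here refl))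
... | before , after , refl = begin
  suc (length xs)                       ≤⟨ s≤s (pigeonhole σ xs (before ++ after) uxs into′ (λ p q → inj (there p) (there q))) ⟩
  suc (length (before ++ after))        ≡⟨ cong suc (List.length-++ before) ⟩
  suc (length before + length after)    ≡⟨ ℕ.+-suc (length before) (length after) ⟨
  length before + suc (length after)    ≡⟨ List.length-++ before ⟨
  length (before ++ σ x ∷ after)        ∎
  where
  open ℕ.≤-Reasoning
  into′ : ∀ {y} → y ∈ xs → σ y ∈ before ++ after
  into′ y∈xs with ∈.∈-++⁻ before (into (there y∈xs))
  ... | inj₁ σy∈                = ∈.∈-++⁺ˡ σy∈
  ... | inj₂ (there σy∈)        = ∈.∈-++⁺ʳ before σy∈
  ... | inj₂ (here σy≡σx)       =
    contradiction (inj (here refl) (there y∈xs) (sym σy≡σx)) (All.lookup x∉xs y∈xs)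

%-≡⇒∣ : ∀ a b m .⦃ _ : NonZero m ⦄ → a ℕ.% m ≡ b ℕ.% m → + m ℤ∣.∣ + a ℤ.- + b
%-≡⇒∣ a b m a%m≡b%m = ℤ∣.divides (+ (a ℕ./ m) ℤ.- + (b ℕ./ m)) (begin
  + a ℤ.- + b
    ≡⟨ cong₂ ℤ._-_ (expand a) (trans (expand b) (cong (λ r → + r ℤ.+ + (b ℕ./ m) ℤ.* + m) (sym a%m≡b%m))) ⟩
  (+ (a ℕ.% m) ℤ.+ + (a ℕ./ m) ℤ.* + m) ℤ.- (+ (a ℕ.% m) ℤ.+ + (b ℕ./ m) ℤ.* + m)
    ≡⟨ cancel (+ (a ℕ.% m)) (+ (a ℕ./ m)) (+ (b ℕ./ m)) (+ m) ⟩
  (+ (a ℕ./ m) ℤ.- + (b ℕ./ m)) ℤ.* + m ∎)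
  where
  open ≡-Reasoning
  expand : ∀ c → + c ≡ + (c ℕ.% m) ℤ.+ + (c ℕ./ m) ℤ.* + m
  expand c = trans (cong +_ (ℕ.m≡m%n+[m/n]*n c m)) (cong (ℤ._+_ (+ (c ℕ.% m))) (ℤ.pos-* (c ℕ./ m) m))
  cancel : ∀ r x y k → (r ℤ.+ x ℤ.* k) ℤ.- (r ℤ.+ y ℤ.* k) ≡ (x ℤ.- y) ℤ.* k
  cancel = ℤ-Ring.solve-∀

module _ (m M : ℕ) .⦃ _ : NonZero m ⦄ (cancel : ∀ x → m ∣ x * M → m ∣ x) where

  -- `cancel` is coprimality of m and M in the form in which it is used: j ↦ jM + r is injective
  -- modulo m.
  ap-injective : ∀ r {i j} → i < m → j < m → (i * M + r) ℕ.% m ≡ (j * M + r) ℕ.% m → i ≡ j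
  ap-injective r {i} {j} i<m j<m eq = congruent-below i<m j<m
    (ℤ∣.∣ᵤ⇒∣ (cancel ℤ.∣ + i ℤ.- + j ∣ (subst (m ∣_) (ℤ.abs-* (+ i ℤ.- + j) (+ M)) (ℤ∣.∣⇒∣ᵤ m∣diff))))
    where
    regroup : ∀ i j k r → (i ℤ.* k ℤ.+ r) ℤ.- (j ℤ.* k ℤ.+ r) ≡ (i ℤ.- j) ℤ.* k
    regroup = ℤ-Ring.solve-∀
    push : ∀ i → + (i * M + r) ≡ + i ℤ.* + M ℤ.+ + r
    push i = cong (ℤ._+ + r) (ℤ.pos-* i M)
    m∣diff : + m ℤ∣.∣ (+ i ℤ.- + j) ℤ.* + M
    m∣diff = subst (+ m ℤ∣.∣_) (trans (cong₂ ℤ._-_ (push i) (push j)) (regroup (+ i) (+ j) (+ M) (+ r)))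
      (%-≡⇒∣ (i * M + r) (j * M + r) m eq)

  ap-count≤ : ∀ {Q : Pred ℕ 0ℓ} (Q? : Decidable Q) → (∀ n → Q n → Q (n ℕ.% m)) → ∀ r →
    ∑ (λ j → 𝟙 (Q? (j * M + r))) m ≤ ∑ (𝟙 ∘ Q?) m
  ap-count≤ Q? reduce r = subst₂ _≤_ (count≡∑ Qr? m) (count≡∑ Q? m)
    (pigeonhole (λ j → (j * M + r) ℕ.% m) _ _ (unique-count Qr? m)
      (λ {j} j∈ → ∈-count⁺ Q? (ℕ.m%n<n (j * M + r) m) (reduce (j * M + r) (proj₂ (∈-count⁻ Qr? {m} j∈))))
      (λ i∈ j∈ → ap-injective r (proj₁ (∈-count⁻ Qr? {m} i∈)) (proj₁ (∈-count⁻ Qr? {m} j∈))))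
    where Qr? = λ j → Q? (j * M + r)

  -- Both Q and its complement satisfy ap-count≤, and both pairs of counts add
  -- up to m.
  ap-count : ∀ {Q : Pred ℕ 0ℓ} (Q? : Decidable Q) →
    (∀ n → Q n → Q (n ℕ.% m)) → (∀ n → Q (n ℕ.% m) → Q n) → ∀ r →
    ∑ (λ j → 𝟙 (Q? (j * M + r))) m ≡ ∑ (𝟙 ∘ Q?) m
  ap-count Q? reduce lift r = ℕ.≤-antisym (ap-count≤ Q? reduce r)
    (ℕ.+-cancelʳ-≤ (∑ (λ j → 𝟙 (¬? (Q? (j * M + r)))) m) _ _ (begin
      ∑ (𝟙 ∘ Q?) m + ∑ (λ j → 𝟙 (¬? (Q? (j * M + r)))) m
        ≤⟨ ℕ.+-monoʳ-≤ (∑ (𝟙 ∘ Q?) m) (ap-count≤ (¬? ∘ Q?) (λ n ¬q q → ¬q (lift n q)) r) ⟩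
      ∑ (𝟙 ∘ Q?) m + ∑ (𝟙 ∘ ¬? ∘ Q?) m
        ≡⟨ total Q? ⟩
      m
        ≡⟨ total (λ j → Q? (j * M + r)) ⟨
      ∑ (λ j → 𝟙 (Q? (j * M + r))) m + ∑ (λ j → 𝟙 (¬? (Q? (j * M + r)))) m ∎))
    where
    open ℕ.≤-Reasoning
    total : ∀ {R : Pred ℕ 0ℓ} (R? : Decidable R) → ∑ (𝟙 ∘ R?) m + ∑ (𝟙 ∘ ¬? ∘ R?) m ≡ m
    total R? = trans (sym (∑-+ _ _ m)) (trans (∑-cong (𝟙+𝟙¬ ∘ R?) m) (∑-one m))

  -- Write n = jM + r with r < M and j < m. The weight f sees only r, and for fixed r the numbers jM
  -- + r meet every residue class modulo m once; hence the sum over j is taken first.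
  ∑-crt : ∀ {f} {Q : Pred ℕ 0ℓ} (Q? : Decidable Q) → Periodic M f →
    (∀ n → Q n → Q (n ℕ.% m)) → (∀ n → Q (n ℕ.% m) → Q n) →
    ∑ (λ n → f n * 𝟙 (Q? n)) (m * M) ≡ ∑ f M * ∑ (𝟙 ∘ Q?) m
  ∑-crt {f} Q? per reduce lift = begin
    ∑ (λ n → f n * 𝟙 (Q? n)) (m * M)
      ≡⟨ ∑-blocks _ m M ⟩
    ∑ (λ j → ∑ (λ r → f (j * M + r) * 𝟙 (Q? (j * M + r))) M) m
      ≡⟨ ∑-cong (λ j → ∑-cong (λ r → cong (_* 𝟙 (Q? (j * M + r))) (periodic-multiple per j r)) M) m ⟩
    ∑ (λ j → ∑ (λ r → f r * 𝟙 (Q? (j * M + r))) M) m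
      ≡⟨ ∑-swap (λ j r → f r * 𝟙 (Q? (j * M + r))) m M ⟩
    ∑ (λ r → ∑ (λ j → f r * 𝟙 (Q? (j * M + r))) m) M
      ≡⟨ ∑-cong (λ r → trans (∑-*ˡ (f r) _ m) (cong (f r *_) (ap-count Q? reduce lift r))) M ⟩
    ∑ (λ r → f r * ∑ (𝟙 ∘ Q?) m) M
      ≡⟨ ∑-*ʳ _ f M ⟩
    ∑ f M * ∑ (𝟙 ∘ Q?) m ∎
    where open ≡-Reasoning

-- The sieve

term≤∑ : ∀ f {n N} → n < N → f n ≤ ∑ f N
term≤∑ f {n} n<N = ℕ.≤-trans (ℕ.m≤n+m (f n) (∑ f n)) (∑-monoʳ f n<N)

prime-divisor : ∀ n → n ≢ 0 → n ≢ 1 → ∃[ p ] Prime p × p ∣ n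
prime-divisor n n≢0 n≢1 with factorise n ⦃ ℕ.≢-nonZero n≢0 ⦄
... | record { factors = [] ; isFactorisation = n≡1 } = contradiction n≡1 n≢1
... | record { factors = p ∷ ps ; isFactorisation = n≡p*ps ; factorsPrime = prime-p ∷ _ } =
  p , prime-p , subst (p ∣_) (sym n≡p*ps) (ℕ.m∣m*n _)

least : ∀ {P : Pred ℕ 0ℓ} → Decidable P → ∀ n → P n → ∃[ d ] IsMinimum P d × d ≤ n
least {P} P? = search 0 (λ ())
  where
  search : ∀ m → (∀ {e} → e < m → ¬ P e) → ∀ k → P (m + k) → ∃[ d ] IsMinimum P d × d ≤ m + k
  search m none zero    Pn = m , (subst P (ℕ.+-identityʳ m) Pn , λ e Pe → ℕ.≮⇒≥ λ e<m → none e<m Pe) , ℕ.m≤m+n m 0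
  search m none (suc k) Pn with P? m
  ... | yes Pm = m , (Pm , λ e Pe → ℕ.≮⇒≥ λ e<m → none e<m Pe) , ℕ.m≤m+n m (suc k)
  ... | no ¬Pm rewrite ℕ.+-suc m k = search (suc m) none′ k Pn
    where
    none′ : ∀ {e} → e < suc m → ¬ P e
    none′ (s≤s e≤m) Pe with ℕ.m≤n⇒m<n∨m≡n e≤m
    ... | inj₁ e<m  = none e<m Pe
    ... | inj₂ refl = ¬Pm Pe

p≤p² : ∀ {p} → Prime p → p ≤ p ^ 2
p≤p² {p} prime-p = ℕ.m≤m*n p (p ^ 1) ⦃ ℕ.m^n≢0 p 1 ⦃ prime⇒nonZero prime-p ⦄ ⦄

module _ (ℓ : ℕ) (prime-ℓ : Prime ℓ) where

  root-periodic : ∀ {d} M n → d ∣ M → d ∣ φ ℓ (M + n) ⇔ d ∣ φ ℓ n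
  root-periodic {d} M n d∣M =
    mk⇔ (φ-shift ℓ prime-ℓ (M + n) n (subst (+ d ℤ∣.∣_) (down (+ M) (+ n)) (ℤ∣.∣m⇒∣-m (ℤ∣.∣ᵤ⇒∣ {+ d} {+ M} d∣M))))
        (φ-shift ℓ prime-ℓ n (M + n) (subst (+ d ℤ∣.∣_) (up (+ M) (+ n)) (ℤ∣.∣ᵤ⇒∣ {+ d} {+ M} d∣M)))
    where
    up : ∀ x y → x ≡ (x ℤ.+ y) ℤ.- y
    up = ℤ-Ring.solve-∀
    down : ∀ x y → ℤ.- x ≡ y ℤ.- (x ℤ.+ y)
    down = ℤ-Ring.solve-∀

  root-% : ∀ d .⦃ _ : NonZero d ⦄ n → d ∣ φ ℓ n ⇔ d ∣ φ ℓ (n ℕ.% d)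
  root-% d n = subst (λ k → d ∣ φ ℓ k ⇔ d ∣ φ ℓ (n ℕ.% d)) (sym (trans (ℕ.m≡m%n+[m/n]*n n d) (ℕ.+-comm (n ℕ.% d) _)))
    (root-periodic (n ℕ./ d * d) (n ℕ.% d) (ℕ.n∣m*n (n ℕ./ d)))

  Bad : ℕ → ℕ → Set
  Bad p n = Prime p × p ^ 2 ∣ φ ℓ n

  abstract
    Bad? : ∀ p → Decidable (Bad p)
    Bad? p n = prime? p ×-dec (p ^ 2 ∣? φ ℓ n)

  Sifted : ℕ → ℕ → Set
  Sifted z n = ∀ {p} → p < suc z → ¬ Bad p n

  abstract
    Sifted? : ∀ z → Decidable (Sifted z)
    Sifted? z n = ℕ.allUpTo? (λ p → ¬? (Bad? p n)) (suc z)

  sifted : ℕ → ℕ → ℕ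
  sifted z n = 𝟙 (Sifted? z n)

  sifted-pred : ∀ {z n} → Sifted (suc z) n → Sifted z n
  sifted-pred s p<1+z = s (ℕ.m<n⇒m<1+n p<1+z)

  sifted-extend : ∀ {z n} → Sifted z n → ¬ Bad (suc z) n → Sifted (suc z) n
  sifted-extend s ¬bad (s≤s p≤1+z) with ℕ.m≤n⇒m<n∨m≡n p≤1+z
  ... | inj₁ p<1+z = s p<1+z
  ... | inj₂ refl  = ¬bad

  sifted-prime : ∀ {z} → Prime (suc z) → ∀ n → sifted (suc z) n ≡ sifted z n * 𝟙 (¬? (suc z ^ 2 ∣? φ ℓ n))
  sifted-prime {z} prime-p n = trans
    (𝟙-cong (Sifted? (suc z) n) (Sifted? z n ×-dec ¬? (suc z ^ 2 ∣? φ ℓ n))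
      (λ s → sifted-pred s , λ p²∣ → s ℕ.≤-refl (prime-p , p²∣))
      (λ (s , p²∤) → sifted-extend s (p²∤ ∘ proj₂)))
    (𝟙-× (Sifted? z n) (¬? (suc z ^ 2 ∣? φ ℓ n)))

  sifted-nonprime : ∀ {z} → ¬ Prime (suc z) → ∀ n → sifted (suc z) n ≡ sifted z n
  sifted-nonprime {z} ¬prime n = 𝟙-cong (Sifted? (suc z) n) (Sifted? z n) sifted-pred
    (λ s → sifted-extend s (¬prime ∘ proj₁))

  modulus : ℕ → ℕ
  modulus zero    = 1
  modulus (suc z) = if does (prime? (suc z)) then suc z ^ 2 * modulus z else modulus z

  modulus-prime : ∀ {z} → Prime (suc z) → modulus (suc z) ≡ suc z ^ 2 * modulus z
  modulus-prime {z} = if-yes (prime? (suc z))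

  modulus-nonprime : ∀ {z} → ¬ Prime (suc z) → modulus (suc z) ≡ modulus z
  modulus-nonprime {z} = if-no (prime? (suc z))

  modulus≢0 : ∀ z → NonZero (modulus z)
  modulus≢0 zero = _
  modulus≢0 (suc z) with does (prime? (suc z))
  ... | true  = ℕ.m*n≢0 (suc z ^ 2) (modulus z) ⦃ ℕ.m^n≢0 (suc z) 2 ⦄ ⦃ modulus≢0 z ⦄
  ... | false = modulus≢0 z

  p²∣modulus : ∀ z {p} → p ≤ z → Prime p → p ^ 2 ∣ modulus z
  p²∣modulus zero    z≤n prime-0 = ⊥-elim (¬prime[0] prime-0)
  p²∣modulus (suc z) p≤1+z prime-p with ℕ.m≤n⇒m<n∨m≡n p≤1+z | prime? (suc z)
  ... | inj₁ (s≤s p≤z) | yes _     = ℕ.∣n⇒∣m*n (suc z ^ 2) (p²∣modulus z p≤z prime-p)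
  ... | inj₁ (s≤s p≤z) | no _      = p²∣modulus z p≤z prime-p
  ... | inj₂ refl      | yes _     = ℕ.m∣m*n (modulus z)
  ... | inj₂ refl      | no ¬prime = contradiction prime-p ¬prime

  -- Contrapositively, a prime z + 1 does not divide `modulus z`, the coprimality that the Chinese
  -- remainder theorem needs.
  prime∣modulus⇒≤ : ∀ z {q} → Prime q → q ∣ modulus z → q ≤ z
  prime∣modulus⇒≤ zero    prime-q q∣1 = ⊥-elim (prime∤1 prime-q q∣1)
  prime∣modulus⇒≤ (suc z) {q} prime-q q∣M with prime? (suc z)
  ... | no _  = ℕ.m≤n⇒m≤1+n (prime∣modulus⇒≤ z prime-q q∣M)
  ... | yes _ with euclidsLemma (suc z ^ 2) (modulus z) prime-q q∣M
  ...   | inj₂ q∣M′ = ℕ.m≤n⇒m≤1+n (prime∣modulus⇒≤ z prime-q q∣M′)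
  ...   | inj₁ q∣p² with euclidsLemma (suc z) (suc z) prime-q (subst (q ∣_) (p²≡p*p (suc z)) q∣p²)
  ...     | inj₁ q∣p = ℕ.∣⇒≤ q∣p
  ...     | inj₂ q∣p = ℕ.∣⇒≤ q∣p

  sifted-periodic : ∀ z → Periodic (modulus z) (sifted z)
  sifted-periodic z n = 𝟙-cong (Sifted? z (modulus z + n)) (Sifted? z n)
    (λ s {p} p<1+z (prime-p , r) → s p<1+z (prime-p , Equivalence.from (shift p<1+z prime-p) r))
    (λ s {p} p<1+z (prime-p , r) → s p<1+z (prime-p , Equivalence.to (shift p<1+z prime-p) r))
    where
    shift : ∀ {p} → p < suc z → Prime p → p ^ 2 ∣ φ ℓ (modulus z + n) ⇔ p ^ 2 ∣ φ ℓ n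
    shift (s≤s p≤z) prime-p = root-periodic (modulus z) n (p²∣modulus z p≤z prime-p)

  roots : ℕ → ℕ → ℕ
  roots d n = 𝟙 (d ∣? φ ℓ n)

  ∑-roots : ∀ d → ∑ (roots d) d ≡ δ ℓ d
  ∑-roots d = sym (count≡∑ (λ a → d ∣? φ ℓ a) d)

  roots+nonroots : ∀ d → ∑ (roots d) d + ∑ (λ n → 𝟙 (¬? (d ∣? φ ℓ n))) d ≡ d
  roots+nonroots d = trans (sym (∑-+ _ _ d)) (trans (∑-cong (λ n → 𝟙+𝟙¬ (d ∣? φ ℓ n)) d) (∑-one d))

  roots-periodic : ∀ d → Periodic d (roots d)
  roots-periodic d n = 𝟙-cong (d ∣? φ ℓ (d + n)) (d ∣? φ ℓ n) (Equivalence.to e) (Equivalence.from e)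
    where e = root-periodic d n ℕ.∣-refl

  -- Only the numerator: the natural density is this number divided by `modulus z`.
  density : ℕ → ℕ
  density z = ∑ (sifted z) (modulus z)

  -- The new condition lives modulo p², coprime to the old modulus, and is met by p² - δ(p²)
  -- residues. The additive form avoids truncated subtraction.
  density-prime : ∀ {z} → Prime (suc z) →
    density (suc z) + density z * δ ℓ (suc z ^ 2) ≡ density z * suc z ^ 2
  density-prime {z} prime-p = begin
    ∑ (sifted (suc z)) (modulus (suc z)) + density z * δ ℓ m
      ≡⟨ cong₂ (λ a b → a + density z * b) (trans (cong (∑ (sifted (suc z))) (modulus-prime prime-p)) crt) (sym (∑-roots m)) ⟩
    density z * ∑ (𝟙 ∘ nonroot?) m + density z * ∑ (roots m) m
      ≡⟨ ℕ.*-distribˡ-+ (density z) _ _ ⟨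
    density z * (∑ (𝟙 ∘ nonroot?) m + ∑ (roots m) m)
      ≡⟨ cong (density z *_) (trans (ℕ.+-comm (∑ (𝟙 ∘ nonroot?) m) _) (roots+nonroots m)) ⟩
    density z * m ∎
    where
    open ≡-Reasoning
    m = suc z ^ 2
    M = modulus z
    instance
      m≢0 : NonZero m
      m≢0 = ℕ.m^n≢0 (suc z) 2
    nonroot? : Decidable (λ n → ¬ (m ∣ φ ℓ n))
    nonroot? n = ¬? (m ∣? φ ℓ n)
    p∤M : ¬ (suc z ∣ M)
    p∤M p∣M = ℕ.<-irrefl refl (prime∣modulus⇒≤ z prime-p p∣M)
    crt : ∑ (sifted (suc z)) (m * M) ≡ density z * ∑ (𝟙 ∘ nonroot?) m
    crt = trans (∑-cong (sifted-prime prime-p) (m * M))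
      (∑-crt m M (λ x → p²-cancel prime-p x M p∤M) nonroot? (sifted-periodic z)
        (λ n ¬r → ¬r ∘ Equivalence.from (root-% m n)) (λ n ¬r → ¬r ∘ Equivalence.to (root-% m n)))

  density-nonprime : ∀ {z} → ¬ Prime (suc z) → density (suc z) ≡ density z
  density-nonprime {z} ¬prime = trans (cong (∑ (sifted (suc z))) (modulus-nonprime ¬prime))
    (∑-cong (sifted-nonprime ¬prime) (modulus z))

  siftedCount : ℕ → ℕ → ℕ
  siftedCount z N = ∑ (sifted z) N

  siftedCount-suc≤ : ∀ z N → siftedCount (suc z) N ≤ siftedCount z N
  siftedCount-suc≤ z = ∑-mono (λ n → 𝟙-mono (Sifted? (suc z) n) (Sifted? z n) sifted-pred)

  siftedCount-antitone : ∀ N {y z} → y ≤ z → siftedCount z N ≤ siftedCount y N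
  siftedCount-antitone N {z = zero}  z≤n = ℕ.≤-refl
  siftedCount-antitone N {z = suc z} y≤1+z with ℕ.m≤n⇒m<n∨m≡n y≤1+z
  ... | inj₁ (s≤s y≤z) = ℕ.≤-trans (siftedCount-suc≤ z N) (siftedCount-antitone N y≤z)
  ... | inj₂ refl      = ℕ.≤-refl

  siftedCount-step : ∀ z N → siftedCount z N ≤ siftedCount (suc z) N + ∑ (λ n → 𝟙 (Bad? (suc z) n)) N
  siftedCount-step z N = ℕ.≤-trans (∑-mono split N) (ℕ.≤-reflexive (∑-+ _ _ N))
    where
    split : ∀ n → sifted z n ≤ sifted (suc z) n + 𝟙 (Bad? (suc z) n)
    split n with Bad? (suc z) n
    ... | yes _   = ℕ.≤-trans (𝟙≤1 (Sifted? z n)) (ℕ.m≤n+m 1 _)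
    ... | no ¬bad = ℕ.≤-trans (𝟙-mono (Sifted? z n) (Sifted? (suc z) n) (λ s → sifted-extend s ¬bad)) (ℕ.m≤m+n _ 0)

  -- For N = ⌊X⌋ + 1 a decidable form of p ∈ S²(ℓ, X).
  Hit : ℕ → ℕ → Set
  Hit N p = Prime p × ∃[ n ] n < N × p ^ 2 ∣ φ ℓ n

  abstract
    Hit? : ∀ N → Decidable (Hit N)
    Hit? N p = prime? p ×-dec ℕ.anyUpTo? (λ n → p ^ 2 ∣? φ ℓ n) N

  -- Complete periods contribute at most ℓ each, and so does the incomplete one. The latter cannot
  -- be paid for at every p up to the size of Φ_ℓ(N), so it is charged only where a root exists.
  ∑-bad : ∀ N p → ℓ < p → .⦃ _ : NonZero (p ^ 2) ⦄ →
    ∑ (λ n → 𝟙 (Bad? p n)) N ≤ ℓ * (N ℕ./ p ^ 2) + ℓ * 𝟙 (Hit? N p)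
  ∑-bad N p ℓ<p with Hit? N p
  ... | no ¬hit = ℕ.≤-trans (ℕ.≤-reflexive (∑-zero N λ {n} n<N →
    𝟙-no (Bad? p n) λ (prime-p , r) → ¬hit (prime-p , n , n<N , r))) z≤n
  ... | yes (prime-p , _) = begin
    ∑ (λ n → 𝟙 (Bad? p n)) N               ≤⟨ ∑-mono (λ n → 𝟙-mono (Bad? p n) (m ∣? φ ℓ n) proj₂) N ⟩
    ∑ (roots m) N                          ≡⟨ cong (∑ (roots m)) (trans (ℕ.m≡m%n+[m/n]*n N m) (ℕ.+-comm (N ℕ.% m) _)) ⟩
    ∑ (roots m) (N ℕ./ m * m + N ℕ.% m)    ≡⟨ ∑-periodic (roots-periodic m) (N ℕ./ m) (N ℕ.% m) ⟩
    N ℕ./ m * ∑ (roots m) m + ∑ (roots m) (N ℕ.% m)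
      ≤⟨ ℕ.+-mono-≤ (ℕ.*-monoʳ-≤ (N ℕ./ m) full) (ℕ.≤-trans (∑-monoʳ (roots m) (ℕ.<⇒≤ (ℕ.m%n<n N m))) full) ⟩
    N ℕ./ m * ℓ + ℓ                        ≡⟨ cong₂ _+_ (ℕ.*-comm (N ℕ./ m) ℓ) (sym (ℕ.*-identityʳ ℓ)) ⟩
    ℓ * (N ℕ./ m) + ℓ * 1                  ∎
    where
    open ℕ.≤-Reasoning
    m = p ^ 2
    full : ∑ (roots m) m ≤ ℓ
    full = ℕ.≤-trans (ℕ.≤-reflexive (∑-roots m)) (δ≤ℓ ℓ prime-ℓ prime-p ℓ<p)

  δ<p² : ∀ {p} → Prime p → δ ℓ (p ^ 2) < p ^ 2
  δ<p² {p} prime-p = begin-strict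
    δ ℓ m                                                   ≡⟨ ∑-roots m ⟨
    ∑ (roots m) m                                           <⟨ ℕ.≤-reflexive (ℕ.+-comm 1 _) ⟩
    ∑ (roots m) m + 1                                       ≤⟨ ℕ.+-monoʳ-≤ (∑ (roots m) m) nonroot ⟩
    ∑ (roots m) m + ∑ (λ n → 𝟙 (¬? (m ∣? φ ℓ n))) m         ≡⟨ roots+nonroots m ⟩
    m                                                       ∎
    where
    open ℕ.≤-Reasoning
    m = p ^ 2
    0<m : 0 < m
    0<m = ℕ.>-nonZero⁻¹ m ⦃ ℕ.m^n≢0 p 2 ⦃ prime⇒nonZero prime-p ⦄ ⦄
    nonroot : 1 ≤ ∑ (λ n → 𝟙 (¬? (m ∣? φ ℓ n))) m
    nonroot = ℕ.≤-trans (ℕ.≤-reflexive (sym (𝟙-yes (¬? (m ∣? φ ℓ 0)) λ m∣φ0 →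
        prime∤1 prime-p (ℕ.∣-trans (ℕ.m∣m*n (p ^ 1)) (root-coprime ℓ prime-ℓ 0 m∣φ0 (m ℕ.∣0))))))
      (term≤∑ (λ n → 𝟙 (¬? (m ∣? φ ℓ n))) 0<m)

  squarefree⇒sifted : ∀ {B n} → SquareFree (Φ ℓ n) → Sifted B n
  squarefree⇒sifted {n = n} sf {p} _ (prime-p , p²∣) = prime∤1 prime-p
    (ℕ.∣-reflexive (sf (+ p) (subst (_∣ φ ℓ n) (trans (p²≡p*p p) (sym (ℤ.abs-* (+ p) (+ p)))) p²∣)))

  prime-bounded : ∀ {p n} → Bad p n → p ≤ φ ℓ n
  prime-bounded {p} {n} (prime-p , p²∣) = ℕ.≤-trans (p≤p² prime-p) (ℕ.∣⇒≤ ⦃ ℕ.≢-nonZero (φ≢0 ℓ prime-ℓ n) ⦄ p²∣)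

  -- If d² ∣ Φ_ℓ(n) with |d| ≠ 1, then d ≠ 0 has a prime factor p, and p ≤ p² ≤ Φ_ℓ(n) ≤ B puts p
  -- within reach of the sieve.
  sifted⇒squarefree : ∀ {B n} → φ ℓ n ≤ B → Sifted B n → SquareFree (Φ ℓ n)
  sifted⇒squarefree {n = n} φn≤B s d dd∣ with ℤ.∣ d ∣ ℕ.≟ 1
  ... | yes ∣d∣≡1 = ∣d∣≡1
  ... | no ∣d∣≢1 = contradiction bad (s (s≤s (ℕ.≤-trans (prime-bounded bad) φn≤B)))
    where
    k = ℤ.∣ d ∣
    kk∣ : k * k ∣ φ ℓ n
    kk∣ = subst (_∣ φ ℓ n) (ℤ.abs-* d d) dd∣
    k≢0 : k ≢ 0
    k≢0 k≡0 = φ≢0 ℓ prime-ℓ n (ℕ.0∣⇒≡0 (subst (λ k → k * k ∣ φ ℓ n) k≡0 kk∣))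
    divisor = prime-divisor k k≢0 ∣d∣≢1
    p = proj₁ divisor
    bad : Bad p n
    bad = proj₁ (proj₂ divisor) , ℕ.∣-trans (subst (_∣ k * k) (sym (p²≡p*p p))
      (ℕ.*-pres-∣ (proj₂ (proj₂ divisor)) (proj₂ (proj₂ divisor)))) kk∣

-- The Euler product

abstract
  -- Opaque, so that identities come from the homomorphism and order laws below and not from
  -- unfolding the normal form of a fraction.
  ι : ℕ → ℚ
  ι n = + n ℚ./ 1

  ι-def : ∀ n → + n ℚ./ 1 ≡ ι n
  ι-def n = refl

  toℚᵘ-ι : ∀ n → ℚ.toℚᵘ (ι n) ℚᵘ.≃ ℚᵘ.mkℚᵘ (+ n) 0
  toℚᵘ-ι n = ℚ.toℚᵘ-fromℚᵘ (ℚᵘ.mkℚᵘ (+ n) 0)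

ι-0 : ι 0 ≡ 0ℚ
ι-0 = sym (ι-def 0)

ι-1 : ι 1 ≡ 1ℚ
ι-1 = sym (ι-def 1)

ι-+ : ∀ m n → ι (m + n) ≡ ι m ℚ.+ ι n
ι-+ m n = ℚ.toℚᵘ-injective (begin
  ℚ.toℚᵘ (ι (m + n))                        ≈⟨ toℚᵘ-ι (m + n) ⟩
  ℚᵘ.mkℚᵘ (+ (m + n)) 0                     ≈⟨ ℚᵘ.*≡* (identity (+ m) (+ n)) ⟩
  ℚᵘ.mkℚᵘ (+ m) 0 ℚᵘ.+ ℚᵘ.mkℚᵘ (+ n) 0      ≈⟨ ℚᵘ.+-cong (toℚᵘ-ι m) (toℚᵘ-ι n) ⟨
  ℚ.toℚᵘ (ι m) ℚᵘ.+ ℚ.toℚᵘ (ι n)            ≈⟨ ℚ.toℚᵘ-homo-+ (ι m) (ι n) ⟨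
  ℚ.toℚᵘ (ι m ℚ.+ ι n)                      ∎)
  where
  open ℚᵘ.≃-Reasoning
  identity : ∀ x y → (x ℤ.+ y) ℤ.* 1ℤ ≡ (x ℤ.* 1ℤ ℤ.+ y ℤ.* 1ℤ) ℤ.* 1ℤ
  identity = ℤ-Ring.solve-∀

fraction-* : ∀ n d .⦃ _ : NonZero d ⦄ → (+ n ℚ./ d) ℚ.* ι d ≡ ι n
fraction-* n (suc d) = ℚ.toℚᵘ-injective (begin
  ℚ.toℚᵘ ((+ n ℚ./ suc d) ℚ.* ι (suc d))                ≈⟨ ℚ.toℚᵘ-homo-* (+ n ℚ./ suc d) (ι (suc d)) ⟩
  ℚ.toℚᵘ (+ n ℚ./ suc d) ℚᵘ.* ℚ.toℚᵘ (ι (suc d))        ≈⟨ ℚᵘ.*-cong (ℚ.toℚᵘ-fromℚᵘ (ℚᵘ.mkℚᵘ (+ n) d)) (toℚᵘ-ι (suc d)) ⟩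
  ℚᵘ.mkℚᵘ (+ n) d ℚᵘ.* ℚᵘ.mkℚᵘ (+ suc d) 0              ≈⟨ ℚᵘ.*≡* (identity (+ n) (+ suc d)) ⟩
  ℚᵘ.mkℚᵘ (+ n) 0                                       ≈⟨ toℚᵘ-ι n ⟨
  ℚ.toℚᵘ (ι n)                                          ∎)
  where
  open ℚᵘ.≃-Reasoning
  identity : ∀ x y → (x ℤ.* y) ℤ.* 1ℤ ≡ x ℤ.* (y ℤ.* 1ℤ)
  identity = ℤ-Ring.solve-∀

ι-* : ∀ m n → ι (m * n) ≡ ι m ℚ.* ι n
ι-* m n = ℚ.toℚᵘ-injective (begin
  ℚ.toℚᵘ (ι (m * n))                        ≈⟨ toℚᵘ-ι (m * n) ⟩
  ℚᵘ.mkℚᵘ (+ (m * n)) 0                     ≈⟨ ℚᵘ.*≡* (cong (ℤ._* 1ℤ) (ℤ.pos-* m n)) ⟩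
  ℚᵘ.mkℚᵘ (+ m) 0 ℚᵘ.* ℚᵘ.mkℚᵘ (+ n) 0      ≈⟨ ℚᵘ.*-cong (toℚᵘ-ι m) (toℚᵘ-ι n) ⟨
  ℚ.toℚᵘ (ι m) ℚᵘ.* ℚ.toℚᵘ (ι n)            ≈⟨ ℚ.toℚᵘ-homo-* (ι m) (ι n) ⟨
  ℚ.toℚᵘ (ι m ℚ.* ι n)                      ∎)
  where open ℚᵘ.≃-Reasoning

ι-mono : ∀ {m n} → m ≤ n → ι m ℚ.≤ ι n
ι-mono {m} {n} m≤n = ℚ.toℚᵘ-cancel-≤ (begin
  ℚ.toℚᵘ (ι m)       ≃⟨ toℚᵘ-ι m ⟩
  ℚᵘ.mkℚᵘ (+ m) 0    ≤⟨ ℚᵘ.*≤* (ℤ.*-monoʳ-≤-nonNeg 1ℤ (ℤ.+≤+ m≤n)) ⟩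
  ℚᵘ.mkℚᵘ (+ n) 0    ≃⟨ toℚᵘ-ι n ⟨
  ℚ.toℚᵘ (ι n)       ∎)
  where open ℚᵘ.≤-Reasoning

≤⇒0≤ : ∀ {p q} → p ℚ.≤ q → 0ℚ ℚ.≤ q ℚ.- p
≤⇒0≤ {p} {q} p≤q = subst (ℚ._≤ q ℚ.- p) (ℚ.+-inverseʳ p) (ℚ.+-monoˡ-≤ (ℚ.- p) p≤q)

-- Certificate form of an inequality: r is assembled with `_⊕_` and `_⊗_` from quantities known to
-- be nonnegative, and the ring solver checks q = p + r. Most estimates below are proved in this
-- way.
≤-slack : ∀ {p q r} → 0ℚ ℚ.≤ r → q ≡ p ℚ.+ r → p ℚ.≤ q
≤-slack {p} {q} {r} 0≤r q≡p+r = begin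
  p           ≡⟨ ℚ.+-identityʳ p ⟨
  p ℚ.+ 0ℚ    ≤⟨ ℚ.+-monoʳ-≤ p 0≤r ⟩
  p ℚ.+ r     ≡⟨ q≡p+r ⟨
  q           ∎
  where open ℚ.≤-Reasoning

infixl 6 _⊕_
infixl 7 _⊗_

_⊕_ : ∀ {p q} → 0ℚ ℚ.≤ p → 0ℚ ℚ.≤ q → 0ℚ ℚ.≤ p ℚ.+ q
_⊕_ {p} {q} 0≤p 0≤q = ℚ.+-mono-≤ 0≤p 0≤q

_⊗_ : ∀ {p q} → 0ℚ ℚ.≤ p → 0ℚ ℚ.≤ q → 0ℚ ℚ.≤ p ℚ.* q
_⊗_ {p} {q} 0≤p 0≤q = subst (ℚ._≤ p ℚ.* q) (ℚ.*-zeroʳ p) (ℚ.*-monoˡ-≤-nonNeg p ⦃ ℚ.nonNegative 0≤p ⦄ 0≤q)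

*-positive : ∀ {p q} → 0ℚ ℚ.< p → 0ℚ ℚ.< q → 0ℚ ℚ.< p ℚ.* q
*-positive {p} {q} 0<p 0<q = subst (ℚ._< p ℚ.* q) (ℚ.*-zeroʳ p) (ℚ.*-monoʳ-<-pos p ⦃ positive 0<p ⦄ 0<q)

0≤ι : ∀ n → 0ℚ ℚ.≤ ι n
0≤ι n = subst (ℚ._≤ ι n) ι-0 (ι-mono {0} {n} z≤n)

0<ι : ∀ n → 0ℚ ℚ.< ι (suc n)
0<ι n = ℚ.<-≤-trans (ℚ.positive⁻¹ 1ℚ) (subst (ℚ._≤ ι (suc n)) ι-1 (ι-mono {1} {suc n} (s≤s z≤n)))

abstract
  u : ℕ → ℚ
  u n = + 1 ℚ./ suc n

  u-inverse : ∀ n → u n ℚ.* ι (suc n) ≡ 1ℚ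
  u-inverse n = trans (fraction-* 1 (suc n)) ι-1

0<u : ∀ n → 0ℚ ℚ.< u n
0<u n = ℚ.*-cancelʳ-<-nonNeg (ι (suc n)) ⦃ ℚ.nonNegative (0≤ι (suc n)) ⦄
  (subst₂ ℚ._<_ (sym (ℚ.*-zeroˡ (ι (suc n)))) (sym (u-inverse n)) (ℚ.positive⁻¹ 1ℚ))

0≤u : ∀ n → 0ℚ ℚ.≤ u n
0≤u n = ℚ.<⇒≤ (0<u n)

u-telescope : ∀ n → u n ℚ.- u (suc n) ≡ u n ℚ.* u (suc n)
u-telescope n = begin
  u n ℚ.- u (suc n)
    ≡⟨ cong₂ ℚ._-_ (sym (ℚ.*-identityʳ (u n))) (sym (ℚ.*-identityʳ (u (suc n)))) ⟩
  u n ℚ.* 1ℚ ℚ.- u (suc n) ℚ.* 1ℚ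
    ≡⟨ cong₂ (λ a b → u n ℚ.* a ℚ.- u (suc n) ℚ.* b)
         (sym (trans (cong (u (suc n) ℚ.*_) (trans (cong (ℚ._+ ι (suc n)) (sym ι-1)) (sym (ι-+ 1 (suc n))))) (u-inverse (suc n)))) (sym (u-inverse n)) ⟩
  u n ℚ.* (u (suc n) ℚ.* (1ℚ ℚ.+ ι (suc n))) ℚ.- u (suc n) ℚ.* (u n ℚ.* ι (suc n))
    ≡⟨ solve 3 (λ a b c → a :* (b :* (con 1ℚ :+ c)) :- b :* (a :* c) := a :* b) refl (u n) (u (suc n)) (ι (suc n)) ⟩
  u n ℚ.* u (suc n) ∎
  where open ≡-Reasoning

-- With `u n` = 1/(n + 1) this is 1/(n + 2)² ≤ 1/(n + 1) - 1/(n + 2), the source of all tail bounds.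
u²≤telescope : ∀ n → u (suc n) ℚ.* u (suc n) ℚ.≤ u n ℚ.- u (suc n)
u²≤telescope n = begin
  u (suc n) ℚ.* u (suc n)    ≤⟨ ℚ.*-monoʳ-≤-nonNeg (u (suc n)) ⦃ ℚ.nonNegative (0≤u (suc n)) ⦄ decreasing ⟩
  u n ℚ.* u (suc n)          ≡⟨ u-telescope n ⟨
  u n ℚ.- u (suc n)          ∎
  where
  open ℚ.≤-Reasoning
  decreasing : u (suc n) ℚ.≤ u n
  decreasing = ≤-slack (0≤u n ⊗ 0≤u (suc n))
    (trans (solve 2 (λ a b → a := b :+ (a :- b)) refl (u n) (u (suc n))) (cong (u (suc n) ℚ.+_) (u-telescope n)))

u²-inverse : ∀ z → u z ℚ.* u z ℚ.* ι (suc z ^ 2) ≡ 1ℚ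
u²-inverse z = begin
  u z ℚ.* u z ℚ.* ι (suc z ^ 2)                      ≡⟨ cong (λ k → u z ℚ.* u z ℚ.* k) (trans (cong ι (p²≡p*p (suc z))) (ι-* (suc z) (suc z))) ⟩
  u z ℚ.* u z ℚ.* (ι (suc z) ℚ.* ι (suc z))          ≡⟨ solve 2 (λ a b → a :* a :* (b :* b) := (a :* b) :* (a :* b)) refl (u z) (ι (suc z)) ⟩
  (u z ℚ.* ι (suc z)) ℚ.* (u z ℚ.* ι (suc z))        ≡⟨ cong₂ ℚ._*_ (u-inverse z) (u-inverse z) ⟩
  1ℚ                                                 ∎
  where open ≡-Reasoning

square-quotient≤ : ∀ z {a b} → 0ℚ ℚ.≤ b ℚ.- a ℚ.* ι (suc z ^ 2) → a ℚ.≤ b ℚ.* (u z ℚ.* u z)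
square-quotient≤ z {a} {b} 0≤ = ≤-slack (0≤ ⊗ (0≤u z ⊗ 0≤u z)) (begin
  b ℚ.* (u z ℚ.* u z)
    ≡⟨ solve 4 (λ a b v m → b :* v := a :* (v :* m) :+ (b :- a :* m) :* v) refl a b (u z ℚ.* u z) m ⟩
  a ℚ.* (u z ℚ.* u z ℚ.* m) ℚ.+ (b ℚ.- a ℚ.* m) ℚ.* (u z ℚ.* u z)
    ≡⟨ cong (ℚ._+ (b ℚ.- a ℚ.* m) ℚ.* (u z ℚ.* u z)) (trans (cong (a ℚ.*_) (u²-inverse z)) (ℚ.*-identityʳ a)) ⟩
  a ℚ.+ (b ℚ.- a ℚ.* m) ℚ.* (u z ℚ.* u z) ∎)
  where
  open ≡-Reasoning
  m = ι (suc z ^ 2)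

module _ (ℓ : ℕ) (prime-ℓ : Prime ℓ) where

  private
    L : ℚ
    L = ι ℓ

  abstract
    P : ℕ → ℚ
    P = partialProduct ℓ

    factor : ℕ → ℚ
    factor z = localFactor ℓ (suc z)

    P≡partialProduct : ∀ z → P z ≡ partialProduct ℓ z
    P≡partialProduct z = refl

    P-zero : P 0 ≡ 1ℚ
    P-zero = refl

    P-prime : ∀ z → Prime (suc z) → P (suc z) ≡ P z ℚ.* factor z
    P-prime z = if-yes (prime? (suc z))

    P-nonprime : ∀ z → ¬ Prime (suc z) → P (suc z) ≡ P z
    P-nonprime z = if-no (prime? (suc z))

    factor-* : ∀ z → factor z ℚ.* ι (suc z ^ 2) ≡ ι (suc z ^ 2) ℚ.- ι (δ ℓ (suc z ^ 2))
    factor-* z = trans (1-q-* (+ d ℚ./ m) (ι m)) (cong (λ t → ι m ℚ.- t) (fraction-* d m))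
      where
      m d : ℕ
      m = suc z ^ 2
      d = δ ℓ m
      instance
        m≢0 : NonZero m
        m≢0 = ℕ.m^n≢0 (suc z) 2
      1-q-* : ∀ q k → (1ℚ ℚ.- q) ℚ.* k ≡ k ℚ.- q ℚ.* k
      1-q-* = solve 2 (λ q k → (con 1ℚ :- q) :* k := k :- q :* k) refl

  factor≤1 : ∀ z → factor z ℚ.≤ 1ℚ
  factor≤1 z = ℚ.*-cancelʳ-≤-pos (ι m) ⦃ positive 0<m ⦄ (≤-slack (0≤ι (δ ℓ m))
    (trans (solve 2 (λ a b → con 1ℚ :* a := (a :- b) :+ b) refl (ι m) (ι (δ ℓ m))) (cong (ℚ._+ ι (δ ℓ m)) (sym (factor-* z)))))
    where
    m = suc z ^ 2
    0<m : 0ℚ ℚ.< ι m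
    0<m = 0<ι (ℕ.pred m)

  0<factor : ∀ z → Prime (suc z) → 0ℚ ℚ.< factor z
  0<factor z prime-p = ℚ.*-cancelʳ-<-nonNeg (ι m) ⦃ ℚ.nonNegative (0≤ι m) ⦄ (begin-strict
    0ℚ ℚ.* ι m                       ≡⟨ ℚ.*-zeroˡ (ι m) ⟩
    0ℚ                               <⟨ ℚ.positive⁻¹ 1ℚ ⟩
    1ℚ                               ≡⟨ solve 1 (λ d → con 1ℚ := (con 1ℚ :+ d) :- d) refl (ι (δ ℓ m)) ⟩
    (1ℚ ℚ.+ ι (δ ℓ m)) ℚ.- ι (δ ℓ m) ≡⟨ cong (ℚ._- ι (δ ℓ m)) (trans (ι-+ 1 (δ ℓ m)) (cong (ℚ._+ ι (δ ℓ m)) ι-1)) ⟨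
    ι (suc (δ ℓ m)) ℚ.- ι (δ ℓ m)    ≤⟨ ℚ.+-monoˡ-≤ (ℚ.- ι (δ ℓ m)) (ι-mono (δ<p² ℓ prime-ℓ prime-p)) ⟩
    ι m ℚ.- ι (δ ℓ m)                ≡⟨ factor-* z ⟨
    factor z ℚ.* ι m    ∎)
    where
    open ℚ.≤-Reasoning
    m = suc z ^ 2

  factor-lower : ∀ z → Prime (suc z) → ℓ < suc z → 1ℚ ℚ.- factor z ℚ.≤ L ℚ.* (u z ℚ.* u z)
  factor-lower z prime-p ℓ<p = square-quotient≤ z {b = L} (subst (0ℚ ℚ.≤_) (begin
    L ℚ.- ι (δ ℓ m)
      ≡⟨ solve 3 (λ a k d → a :- d := a :- (k :- (k :- d))) refl L (ι m) (ι (δ ℓ m)) ⟩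
    L ℚ.- (ι m ℚ.- (ι m ℚ.- ι (δ ℓ m)))
      ≡⟨ cong (λ t → L ℚ.- (ι m ℚ.- t)) (factor-* z) ⟨
    L ℚ.- (ι m ℚ.- factor z ℚ.* ι m)
      ≡⟨ solve 3 (λ a k f → a :- (k :- f :* k) := a :- (con 1ℚ :- f) :* k) refl L (ι m) (factor z) ⟩
    L ℚ.- (1ℚ ℚ.- factor z) ℚ.* ι m ∎)
    (≤⇒0≤ (ι-mono (δ≤ℓ ℓ prime-ℓ prime-p ℓ<p))))
    where
    open ≡-Reasoning
    m = suc z ^ 2

  0<P : ∀ z → 0ℚ ℚ.< P z
  0<P zero    = subst (0ℚ ℚ.<_) (sym P-zero) (ℚ.positive⁻¹ 1ℚ)
  0<P (suc z) = case-prime (prime? (suc z))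
    where
    case-prime : Dec (Prime (suc z)) → 0ℚ ℚ.< P (suc z)
    case-prime (yes prime-p) = subst (0ℚ ℚ.<_) (sym (P-prime z prime-p)) (*-positive (0<P z) (0<factor z prime-p))
    case-prime (no ¬prime)   = subst (0ℚ ℚ.<_) (sym (P-nonprime z ¬prime)) (0<P z)

  0≤P : ∀ z → 0ℚ ℚ.≤ P z
  0≤P z = ℚ.<⇒≤ (0<P z)

  P-antitone-suc : ∀ z → P (suc z) ℚ.≤ P z
  P-antitone-suc z = case-prime (prime? (suc z))
    where
    case-prime : Dec (Prime (suc z)) → P (suc z) ℚ.≤ P z
    case-prime (yes prime-p) = ≤-slack (0≤P z ⊗ ≤⇒0≤ (factor≤1 z))
      (trans (solve 2 (λ a f → a := a :* f :+ a :* (con 1ℚ :- f)) refl (P z) (factor z))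
        (cong (ℚ._+ P z ℚ.* (1ℚ ℚ.- factor z)) (sym (P-prime z prime-p))))
    case-prime (no ¬prime)   = ℚ.≤-reflexive (P-nonprime z ¬prime)

  P-antitone : ∀ {m n} → m ≤ n → P n ℚ.≤ P m
  P-antitone {n = zero}  z≤n = ℚ.≤-refl
  P-antitone {n = suc n} m≤1+n with ℕ.m≤n⇒m<n∨m≡n m≤1+n
  ... | inj₁ (s≤s m≤n) = ℚ.≤-trans (P-antitone-suc n) (P-antitone m≤n)
  ... | inj₂ refl      = ℚ.≤-refl

  P≤1 : ∀ z → P z ℚ.≤ 1ℚ
  P≤1 z = subst (P z ℚ.≤_) P-zero (P-antitone {0} z≤n)

  -- Passing the prime b + 2 loses (1 - f) P(b + 1), where 1 - f ≤ ℓ/(b + 2)² telescopes and P(b +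
  -- 1) ≤ P(z + 1). Keeping the factor P(z + 1) makes the loss relative, which yields a positive
  -- lower bound for the product as well as convergence.
  P-tail : ∀ {z b} → ℓ ≤ suc z → z ≤ b → P (suc z) ℚ.≤ P (suc b) ℚ.+ L ℚ.* (u z ℚ.- u b) ℚ.* P (suc z)
  P-tail {z} {zero} ℓ≤ z≤n = ℚ.≤-reflexive (solve 3 (λ p l a → p := p :+ l :* (a :- a) :* p) refl (P 1) L (u 0))
  P-tail {z} {suc b} ℓ≤ z≤1+b with ℕ.m≤n⇒m<n∨m≡n z≤1+b
  ... | inj₂ refl = ℚ.≤-reflexive (solve 3 (λ p l a → p := p :+ l :* (a :- a) :* p) refl (P (suc z)) L (u z))
  ... | inj₁ (s≤s z≤b) = begin
    P (suc z)
      ≤⟨ P-tail ℓ≤ z≤b ⟩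
    P (suc b) ℚ.+ L ℚ.* (u z ℚ.- u b) ℚ.* P (suc z)
      ≤⟨ ℚ.+-monoˡ-≤ (L ℚ.* (u z ℚ.- u b) ℚ.* P (suc z)) (step (prime? (suc (suc b)))) ⟩
    (P (suc (suc b)) ℚ.+ L ℚ.* (u b ℚ.- u (suc b)) ℚ.* P (suc z)) ℚ.+ L ℚ.* (u z ℚ.- u b) ℚ.* P (suc z)
      ≡⟨ solve 6 (λ q l p x y w → (q :+ l :* (y :- w) :* p) :+ l :* (x :- y) :* p := q :+ l :* (x :- w) :* p) refl
           (P (suc (suc b))) L (P (suc z)) (u z) (u b) (u (suc b)) ⟩
    P (suc (suc b)) ℚ.+ L ℚ.* (u z ℚ.- u (suc b)) ℚ.* P (suc z) ∎
    where
    open ℚ.≤-Reasoning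
    0≤t : 0ℚ ℚ.≤ u b ℚ.- u (suc b)
    0≤t = subst (0ℚ ℚ.≤_) (sym (u-telescope b)) (0≤u b ⊗ 0≤u (suc b))
    step : Dec (Prime (suc (suc b))) → P (suc b) ℚ.≤ P (suc (suc b)) ℚ.+ L ℚ.* (u b ℚ.- u (suc b)) ℚ.* P (suc z)
    step (no ¬prime) = ≤-slack (0≤ι ℓ ⊗ 0≤t ⊗ 0≤P (suc z))
      (cong (ℚ._+ L ℚ.* (u b ℚ.- u (suc b)) ℚ.* P (suc z)) (P-nonprime (suc b) ¬prime))
    step (yes prime-p) = begin
      P (suc b)
        ≡⟨ solve 2 (λ p f → p := p :* f :+ (con 1ℚ :- f) :* p) refl (P (suc b)) f ⟩
      P (suc b) ℚ.* f ℚ.+ (1ℚ ℚ.- f) ℚ.* P (suc b)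
        ≡⟨ cong (ℚ._+ (1ℚ ℚ.- f) ℚ.* P (suc b)) (P-prime (suc b) prime-p) ⟨
      P (suc (suc b)) ℚ.+ (1ℚ ℚ.- f) ℚ.* P (suc b)
        ≤⟨ ℚ.+-monoʳ-≤ (P (suc (suc b))) (ℚ.≤-trans
             (ℚ.*-monoʳ-≤-nonNeg (P (suc b)) ⦃ ℚ.nonNegative (0≤P (suc b)) ⦄ 1-f≤)
             (ℚ.*-monoˡ-≤-nonNeg (L ℚ.* (u b ℚ.- u (suc b))) ⦃ ℚ.nonNegative (0≤ι ℓ ⊗ 0≤t) ⦄ (P-antitone (s≤s z≤b)))) ⟩
      P (suc (suc b)) ℚ.+ L ℚ.* (u b ℚ.- u (suc b)) ℚ.* P (suc z) ∎
      where
      f = factor (suc b)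
      1-f≤ : 1ℚ ℚ.- f ℚ.≤ L ℚ.* (u b ℚ.- u (suc b))
      1-f≤ = ℚ.≤-trans (factor-lower (suc b) prime-p (s≤s (ℕ.≤-trans ℓ≤ (s≤s z≤b))))
        (ℚ.*-monoˡ-≤-nonNeg L ⦃ ℚ.nonNegative (0≤ι ℓ) ⦄ (u²≤telescope b))

  -- At a prime p both sides are multiplied by p² - δ(p²): on the right, p² enters through the
  -- modulus and 1 - δ(p²)/p² through the product.
  density-P : ∀ z → ι (density ℓ prime-ℓ z) ≡ P z ℚ.* ι (modulus ℓ prime-ℓ z)
  density-P zero = trans (cong ι density-zero) (trans ι-1 (sym (cong₂ ℚ._*_ P-zero ι-1)))
    where
    density-zero : density ℓ prime-ℓ 0 ≡ 1
    density-zero = 𝟙-yes (Sifted? ℓ prime-ℓ 0 0) λ { (s≤s z≤n) (prime-0 , _) → ¬prime[0] prime-0 }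
  density-P (suc z) = case-prime (prime? (suc z))
    where
    open ≡-Reasoning
    D = density ℓ prime-ℓ z
    M = modulus ℓ prime-ℓ z
    m = suc z ^ 2
    f = factor z
    case-prime : Dec (Prime (suc z)) → ι (density ℓ prime-ℓ (suc z)) ≡ P (suc z) ℚ.* ι (modulus ℓ prime-ℓ (suc z))
    case-prime (no ¬prime) = trans (cong ι (density-nonprime ℓ prime-ℓ ¬prime)) (trans (density-P z)
      (sym (cong₂ (λ p k → p ℚ.* ι k) (P-nonprime z ¬prime) (modulus-nonprime ℓ prime-ℓ ¬prime))))
    case-prime (yes prime-p) = begin
      ι D′
        ≡⟨ solve 2 (λ a b → a := (a :+ b) :- b) refl (ι D′) (ι D ℚ.* ι (δ ℓ m)) ⟩
      (ι D′ ℚ.+ ι D ℚ.* ι (δ ℓ m)) ℚ.- ι D ℚ.* ι (δ ℓ m)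
        ≡⟨ cong (ℚ._- ι D ℚ.* ι (δ ℓ m)) (begin
             ι D′ ℚ.+ ι D ℚ.* ι (δ ℓ m)    ≡⟨ cong (ι D′ ℚ.+_) (ι-* D (δ ℓ m)) ⟨
             ι D′ ℚ.+ ι (D * δ ℓ m)        ≡⟨ ι-+ D′ (D * δ ℓ m) ⟨
             ι (D′ + D * δ ℓ m)            ≡⟨ cong ι (density-prime ℓ prime-ℓ prime-p) ⟩
             ι (D * m)                     ≡⟨ ι-* D m ⟩
             ι D ℚ.* ι m                   ∎) ⟩
      ι D ℚ.* ι m ℚ.- ι D ℚ.* ι (δ ℓ m)
        ≡⟨ solve 3 (λ d k e → d :* k :- d :* e := d :* (k :- e)) refl (ι D) (ι m) (ι (δ ℓ m)) ⟩
      ι D ℚ.* (ι m ℚ.- ι (δ ℓ m))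
        ≡⟨ cong₂ ℚ._*_ (density-P z) (sym (factor-* z)) ⟩
      P z ℚ.* ι M ℚ.* (f ℚ.* ι m)
        ≡⟨ solve 4 (λ p k f m → p :* k :* (f :* m) := p :* f :* (m :* k)) refl (P z) (ι M) f (ι m) ⟩
      P z ℚ.* f ℚ.* (ι m ℚ.* ι M)
        ≡⟨ cong₂ ℚ._*_ (P-prime z prime-p) (ι-* m M) ⟨
      P (suc z) ℚ.* ι (m * M)
        ≡⟨ cong (λ k → P (suc z) ℚ.* ι k) (modulus-prime ℓ prime-ℓ prime-p) ⟨
      P (suc z) ℚ.* ι (modulus ℓ prime-ℓ (suc z)) ∎
      where D′ = density ℓ prime-ℓ (suc z)

-- Convergence and positivity of the product; error terms of the sieve

*-monoˡ : ∀ {p q r} → 0ℚ ℚ.≤ r → p ℚ.≤ q → r ℚ.* p ℚ.≤ r ℚ.* q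
*-monoˡ {r = r} 0≤r = ℚ.*-monoˡ-≤-nonNeg r ⦃ ℚ.nonNegative 0≤r ⦄

*-monoʳ : ∀ {p q r} → 0ℚ ℚ.≤ r → p ℚ.≤ q → p ℚ.* r ℚ.≤ q ℚ.* r
*-monoʳ {r = r} 0≤r = ℚ.*-monoʳ-≤-nonNeg r ⦃ ℚ.nonNegative 0≤r ⦄

archimedean : ∀ q → ∃[ n ] q ℚ.≤ ι n
archimedean q@(ℚ.mkℚ (+ n) d _) = n , subst (q ℚ.≤_) (ι-def n) (ℚ.toℚᵘ-cancel-≤ (begin
  ℚᵘ.mkℚᵘ (+ n) d               ≤⟨ ℚᵘ.*≤* (ℤ.*-monoˡ-≤-nonNeg (+ n) (ℤ.+≤+ {1} {suc d} (s≤s z≤n))) ⟩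
  ℚᵘ.mkℚᵘ (+ n) 0               ≃⟨ ℚ.toℚᵘ-fromℚᵘ (ℚᵘ.mkℚᵘ (+ n) 0) ⟨
  ℚ.toℚᵘ (+ n ℚ./ 1)            ∎))
  where open ℚᵘ.≤-Reasoning
archimedean q@(ℚ.mkℚ ℤ.-[1+ n ] d _) = 0 , subst (q ℚ.≤_) (ι-def 0) (ℚ.*≤* ℤ.-≤+)

archimedean-* : ∀ {ε} → 0ℚ ℚ.< ε → ∀ q → ∃[ n ] q ℚ.≤ ε ℚ.* ι n
archimedean-* {ε} 0<ε q = let n , r≤n = archimedean (ε⁻¹ ℚ.* q) in n , (begin
  q                          ≡⟨ ℚ.*-identityˡ q ⟨
  1ℚ ℚ.* q                   ≡⟨ cong (ℚ._* q) (ℚ.*-inverseʳ ε) ⟨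
  ε ℚ.* ε⁻¹ ℚ.* q            ≡⟨ ℚ.*-assoc ε ε⁻¹ q ⟩
  ε ℚ.* (ε⁻¹ ℚ.* q)          ≤⟨ *-monoˡ (ℚ.<⇒≤ 0<ε) r≤n ⟩
  ε ℚ.* ι n                  ∎)
  where
  open ℚ.≤-Reasoning
  instance
    ε≢0 : ℚ.NonZero ε
    ε≢0 = ℚ.pos⇒nonZero ε ⦃ positive 0<ε ⦄
  ε⁻¹ = ℚ.1/ ε

-- For k = ℓ a single z both makes ℓ/(z + 1) small and lies beyond ℓ, where the bound δ(p²) ≤ ℓ is
-- available.
small-u : ∀ {ε} → 0ℚ ℚ.< ε → ∀ k → ∃[ z ] k ≤ z × ι k ℚ.* u z ℚ.≤ ε
small-u {ε} 0<ε k = let n , k≤εn = archimedean-* 0<ε (ι k) in n ⊔ k , ℕ.m≤n⊔m n k , bound n k≤εn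
  where
  open ℚ.≤-Reasoning
  bound : ∀ n → ι k ℚ.≤ ε ℚ.* ι n → ι k ℚ.* u (n ⊔ k) ℚ.≤ ε
  bound n k≤εn = begin
    ι k ℚ.* u z                    ≤⟨ *-monoʳ (0≤u z) k≤εn ⟩
    ε ℚ.* ι n ℚ.* u z              ≤⟨ *-monoʳ (0≤u z) (*-monoˡ (ℚ.<⇒≤ 0<ε) (ι-mono (ℕ.m≤n⇒m≤1+n (ℕ.m≤m⊔n n k)))) ⟩
    ε ℚ.* ι (suc z) ℚ.* u z        ≡⟨ solve 3 (λ e i v → e :* i :* v := e :* (v :* i)) refl ε (ι (suc z)) (u z) ⟩
    ε ℚ.* (u z ℚ.* ι (suc z))      ≡⟨ cong (ε ℚ.*_) (u-inverse z) ⟩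
    ε ℚ.* 1ℚ                       ≡⟨ ℚ.*-identityʳ ε ⟩
    ε                              ∎
    where z = n ⊔ k

∣-∣≤ : ∀ {p q r} → p ℚ.≤ q ℚ.+ r → q ℚ.≤ p ℚ.+ r → ℚ.∣ p ℚ.- q ∣ ℚ.≤ r
∣-∣≤ {p} {q} {r} p≤q+r q≤p+r with ℚ.∣p∣≡p∨∣p∣≡-p (p ℚ.- q)
... | inj₁ eq = subst (ℚ._≤ r) (sym eq) (≤-slack (≤⇒0≤ p≤q+r)
  (solve 3 (λ p q r → r := (p :- q) :+ (q :+ r :- p)) refl p q r))
... | inj₂ eq = subst (ℚ._≤ r) (sym eq) (≤-slack (≤⇒0≤ q≤p+r)
  (solve 3 (λ p q r → r := (:- (p :- q)) :+ (p :+ r :- q)) refl p q r))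

module _ (ℓ : ℕ) (prime-ℓ : Prime ℓ) where

  private
    L : ℚ
    L = ι ℓ
    Π : ℕ → ℚ
    Π = P ℓ prime-ℓ

  P-close : ∀ {z b} → ℓ ≤ suc z → z ≤ b → Π (suc z) ℚ.≤ Π (suc b) ℚ.+ L ℚ.* u z
  P-close {z} {b} ℓ≤ z≤b = begin
    Π (suc z)                                              ≤⟨ P-tail ℓ prime-ℓ ℓ≤ z≤b ⟩
    Π (suc b) ℚ.+ L ℚ.* (u z ℚ.- u b) ℚ.* Π (suc z)        ≤⟨ ≤-slack (0≤ι ℓ ⊗ (0≤u b ⊗ 0≤P ℓ prime-ℓ (suc z) ⊕ 0≤u z ⊗ ≤⇒0≤ (P≤1 ℓ prime-ℓ (suc z))))
                                                                (solve 5 (λ q l a b p → q :+ l :* a := (q :+ l :* (a :- b) :* p) :+ l :* (b :* p :+ a :* (con 1ℚ :- p))) refl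
                                                                  (Π (suc b)) L (u z) (u b) (Π (suc z))) ⟩
    Π (suc b) ℚ.+ L ℚ.* u z                                ∎
    where open ℚ.≤-Reasoning

  P-cauchy : IsCauchy Π
  P-cauchy ε 0<ε = let z , ℓ≤z , Lu≤ε = small-u 0<ε ℓ in suc z , λ m n z<m z<n →
    ∣-∣≤ {Π m} {Π n} {ε} (close z ℓ≤z Lu≤ε m n z<m z<n) (close z ℓ≤z Lu≤ε n m z<n z<m)
    where
    open ℚ.≤-Reasoning
    close : ∀ z → ℓ ≤ z → L ℚ.* u z ℚ.≤ ε → ∀ m n → suc z ≤ m → suc z ≤ n → Π m ℚ.≤ Π n ℚ.+ ε
    close z ℓ≤z Lu≤ε m (suc b) z<m (s≤s z≤b) = begin
      Π m                       ≤⟨ P-antitone ℓ prime-ℓ z<m ⟩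
      Π (suc z)                 ≤⟨ P-close (ℕ.m≤n⇒m≤1+n ℓ≤z) z≤b ⟩
      Π (suc b) ℚ.+ L ℚ.* u z   ≤⟨ ℚ.+-monoʳ-≤ (Π (suc b)) Lu≤ε ⟩
      Π (suc b) ℚ.+ ε           ∎

  P-bounded-below : ∃[ c ] 0ℚ ℚ.< c × (∀ n → c ℚ.≤ Π n)
  P-bounded-below = c , *-positive (ℚ.positive⁻¹ ½) (0<P ℓ prime-ℓ (suc z)) , bound
    where
    -- With z = 2ℓ the relative loss ℓ · `u z` = ℓ/(2ℓ + 1) is below ½, so at least half of P(z + 1)
    -- survives.
    z = ℓ + ℓ
    c = ½ ℚ.* Π (suc z)
    v : 1ℚ ≡ u z ℚ.* (1ℚ ℚ.+ (L ℚ.+ L))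
    v = trans (sym (u-inverse z)) (cong (u z ℚ.*_) (trans (ι-+ 1 z) (cong₂ ℚ._+_ ι-1 (ι-+ ℓ ℓ))))
    0≤½ : 0ℚ ℚ.≤ ½
    0≤½ = ℚ.nonNegative⁻¹ ½
    open ℚ.≤-Reasoning
    tail : ∀ {b} → z ≤ b → c ℚ.≤ Π (suc b)
    tail {b} z≤b = ≤-slack
      (≤⇒0≤ (P-tail ℓ prime-ℓ (ℕ.m≤n⇒m≤1+n (ℕ.m≤m+n ℓ ℓ)) z≤b) ⊕ (0≤ι ℓ ⊗ 0≤u b ⊕ 0≤½ ⊗ 0≤u z) ⊗ 0≤P ℓ prime-ℓ (suc z))
      (begin-equality
        Π (suc b)
          ≡⟨ solve 2 (λ q p → q := con ½ :* p :+ (q :+ con ½ :* con 1ℚ :* p :- p)) refl (Π (suc b)) (Π (suc z)) ⟩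
        c ℚ.+ (Π (suc b) ℚ.+ ½ ℚ.* 1ℚ ℚ.* Π (suc z) ℚ.- Π (suc z))
          ≡⟨ cong (λ t → c ℚ.+ (Π (suc b) ℚ.+ ½ ℚ.* t ℚ.* Π (suc z) ℚ.- Π (suc z))) v ⟩
        c ℚ.+ (Π (suc b) ℚ.+ ½ ℚ.* (u z ℚ.* (1ℚ ℚ.+ (L ℚ.+ L))) ℚ.* Π (suc z) ℚ.- Π (suc z))
          ≡⟨ solve 5 (λ q p l a b → con ½ :* p :+ (q :+ con ½ :* (a :* (con 1ℚ :+ (l :+ l))) :* p :- p)
               := con ½ :* p :+ ((q :+ l :* (a :- b) :* p :- p) :+ (l :* b :+ con ½ :* a) :* p)) refl
               (Π (suc b)) (Π (suc z)) L (u z) (u b) ⟩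
        c ℚ.+ ((Π (suc b) ℚ.+ L ℚ.* (u z ℚ.- u b) ℚ.* Π (suc z) ℚ.- Π (suc z))
          ℚ.+ (L ℚ.* u b ℚ.+ ½ ℚ.* u z) ℚ.* Π (suc z)) ∎)
    bound : ∀ n → c ℚ.≤ Π n
    bound n = [ below , above n ]′ (ℕ.≤-total n (suc z))
      where
      below : n ≤ suc z → c ℚ.≤ Π n
      below n≤1+z = begin
        c               ≤⟨ tail ℕ.≤-refl ⟩
        Π (suc z)       ≤⟨ P-antitone ℓ prime-ℓ n≤1+z ⟩
        Π n             ∎
      above : ∀ n → suc z ≤ n → c ℚ.≤ Π n
      above (suc b) (s≤s z≤b) = tail z≤b

  -- `∑-bad` is added up over z + 1 < p ≤ b + 1; for composite p the left side of `∑-bad` is 0, so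
  -- all integers may be included and the squares telescope. Counting the hits at p ≤ z + 1 too only
  -- enlarges the bound.
  siftedCount-tail : ∀ N {z b} → ℓ ≤ suc z → z ≤ b →
    ι (siftedCount ℓ prime-ℓ (suc z) N) ℚ.≤
      ι (siftedCount ℓ prime-ℓ (suc b) N) ℚ.+ L ℚ.* ι N ℚ.* (u z ℚ.- u b)
        ℚ.+ L ℚ.* ι (∑ (𝟙 ∘ Hit? ℓ prime-ℓ N) (suc (suc b)))
  siftedCount-tail N {z} {b} ℓ≤ z≤b = go b z≤b
    where
    A : ℕ → ℚ
    A b = ι (siftedCount ℓ prime-ℓ b N)
    H : ℕ → ℚ
    H b = ι (∑ (𝟙 ∘ Hit? ℓ prime-ℓ N) b)
    open ℚ.≤-Reasoning
    base : A (suc z) ℚ.≤ A (suc z) ℚ.+ L ℚ.* ι N ℚ.* (u z ℚ.- u z) ℚ.+ L ℚ.* H (suc (suc z))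
    base = ≤-slack (0≤ι ℓ ⊗ 0≤ι (∑ (𝟙 ∘ Hit? ℓ prime-ℓ N) (suc (suc z))))
      (solve 5 (λ a l n x h → a :+ l :* n :* (x :- x) :+ l :* h := a :+ l :* h) refl
        (A (suc z)) L (ι N) (u z) (H (suc (suc z))))
    step : ∀ b → z ≤ b → A (suc b) ℚ.≤ A (suc (suc b)) ℚ.+ L ℚ.* ι N ℚ.* (u b ℚ.- u (suc b))
      ℚ.+ L ℚ.* ι (𝟙 (Hit? ℓ prime-ℓ N (suc (suc b))))
    step b z≤b = begin
      A (suc b)
        ≤⟨ ι-mono (siftedCount-step ℓ prime-ℓ (suc b) N) ⟩
      ι (siftedCount ℓ prime-ℓ p N + bad)
        ≡⟨ ι-+ (siftedCount ℓ prime-ℓ p N) bad ⟩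
      A p ℚ.+ ι bad
        ≤⟨ ℚ.+-monoʳ-≤ (A p) bad≤ ⟩
      A p ℚ.+ (L ℚ.* ι (N ℕ./ p ^ 2) ℚ.+ L ℚ.* ι h)
        ≤⟨ ℚ.+-monoʳ-≤ (A p) (ℚ.+-monoˡ-≤ (L ℚ.* ι h) (*-monoˡ (0≤ι ℓ) quotient≤)) ⟩
      A p ℚ.+ (L ℚ.* (ι N ℚ.* (u b ℚ.- u (suc b))) ℚ.+ L ℚ.* ι h)
        ≡⟨ solve 5 (λ a l n t h → a :+ (l :* (n :* t) :+ l :* h) := a :+ l :* n :* t :+ l :* h) refl
             (A p) L (ι N) (u b ℚ.- u (suc b)) (ι h) ⟩
      A p ℚ.+ L ℚ.* ι N ℚ.* (u b ℚ.- u (suc b)) ℚ.+ L ℚ.* ι h ∎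
      where
      p bad h : ℕ
      p = suc (suc b)
      bad = ∑ (λ n → 𝟙 (Bad? ℓ prime-ℓ p n)) N
      h = 𝟙 (Hit? ℓ prime-ℓ N p)
      instance
        p²≢0 : NonZero (p ^ 2)
        p²≢0 = ℕ.m^n≢0 p 2
      bad≤ : ι bad ℚ.≤ L ℚ.* ι (N ℕ./ p ^ 2) ℚ.+ L ℚ.* ι h
      bad≤ = begin
        ι bad                                    ≤⟨ ι-mono (∑-bad ℓ prime-ℓ N p (s≤s (ℕ.≤-trans ℓ≤ (s≤s z≤b)))) ⟩
        ι (ℓ * (N ℕ./ p ^ 2) + ℓ * h)            ≡⟨ ι-+ (ℓ * (N ℕ./ p ^ 2)) (ℓ * h) ⟩
        ι (ℓ * (N ℕ./ p ^ 2)) ℚ.+ ι (ℓ * h)      ≡⟨ cong₂ ℚ._+_ (ι-* ℓ (N ℕ./ p ^ 2)) (ι-* ℓ h) ⟩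
        L ℚ.* ι (N ℕ./ p ^ 2) ℚ.+ L ℚ.* ι h      ∎
      quotient≤ : ι (N ℕ./ p ^ 2) ℚ.≤ ι N ℚ.* (u b ℚ.- u (suc b))
      quotient≤ = ℚ.≤-trans
        (square-quotient≤ (suc b) {b = ι N} (≤⇒0≤ (subst (ℚ._≤ ι N) (ι-* (N ℕ./ p ^ 2) (p ^ 2)) (ι-mono (ℕ.m/n*n≤m N (p ^ 2))))))
        (*-monoˡ (0≤ι N) (u²≤telescope b))
    go : ∀ b → z ≤ b → A (suc z) ℚ.≤ A (suc b) ℚ.+ L ℚ.* ι N ℚ.* (u z ℚ.- u b) ℚ.+ L ℚ.* H (suc (suc b))
    go zero    z≤n = base
    go (suc b) z≤1+b = [ below , (λ { refl → base }) ]′ (ℕ.m≤n⇒m<n∨m≡n z≤1+b)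
      where
      p h : ℕ
      p = suc (suc b)
      h = 𝟙 (Hit? ℓ prime-ℓ N p)
      below : suc z ≤ suc b → A (suc z) ℚ.≤ A (suc (suc b)) ℚ.+ L ℚ.* ι N ℚ.* (u z ℚ.- u (suc b)) ℚ.+ L ℚ.* H (suc (suc (suc b)))
      below (s≤s z≤b) = begin
        A (suc z)
          ≤⟨ go b z≤b ⟩
        A (suc b) ℚ.+ L ℚ.* ι N ℚ.* (u z ℚ.- u b) ℚ.+ L ℚ.* H (suc (suc b))
          ≤⟨ ℚ.+-monoˡ-≤ (L ℚ.* H (suc (suc b))) (ℚ.+-monoˡ-≤ (L ℚ.* ι N ℚ.* (u z ℚ.- u b)) (step b z≤b)) ⟩
        A p ℚ.+ L ℚ.* ι N ℚ.* (u b ℚ.- u (suc b)) ℚ.+ L ℚ.* ι h ℚ.+ L ℚ.* ι N ℚ.* (u z ℚ.- u b) ℚ.+ L ℚ.* H (suc (suc b))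
          ≡⟨ solve 8 (λ a l n x y w h k → a :+ l :* n :* (y :- w) :+ l :* h :+ l :* n :* (x :- y) :+ l :* k
               := a :+ l :* n :* (x :- w) :+ l :* (k :+ h)) refl
               (A p) L (ι N) (u z) (u b) (u (suc b)) (ι h) (H (suc (suc b))) ⟩
        A p ℚ.+ L ℚ.* ι N ℚ.* (u z ℚ.- u (suc b)) ℚ.+ L ℚ.* (H (suc (suc b)) ℚ.+ ι h)
          ≡⟨ cong (λ t → A p ℚ.+ L ℚ.* ι N ℚ.* (u z ℚ.- u (suc b)) ℚ.+ L ℚ.* t)
               (sym (ι-+ (∑ (𝟙 ∘ Hit? ℓ prime-ℓ N) p) h)) ⟩
        A p ℚ.+ L ℚ.* ι N ℚ.* (u z ℚ.- u (suc b)) ℚ.+ L ℚ.* H (suc p) ∎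

  module _ (z N : ℕ) where
    private
      M q r R : ℕ
      M = modulus ℓ prime-ℓ z
      q = (N ℕ./ M) ⦃ modulus≢0 ℓ prime-ℓ z ⦄
      r = (N ℕ.% M) ⦃ modulus≢0 ℓ prime-ℓ z ⦄
      R = ∑ (sifted ℓ prime-ℓ z) r

      N≡ : ι N ≡ ι q ℚ.* ι M ℚ.+ ι r
      N≡ = trans (cong ι (trans (ℕ.m≡m%n+[m/n]*n N M ⦃ modulus≢0 ℓ prime-ℓ z ⦄) (ℕ.+-comm r (q * M))))
        (trans (ι-+ (q * M) r) (cong (ℚ._+ ι r) (ι-* q M)))

      A≡ : ι (siftedCount ℓ prime-ℓ z N) ≡ ι q ℚ.* (Π z ℚ.* ι M) ℚ.+ ι R
      A≡ = trans (cong ι (trans (cong (siftedCount ℓ prime-ℓ z) (trans (ℕ.m≡m%n+[m/n]*n N M ⦃ modulus≢0 ℓ prime-ℓ z ⦄) (ℕ.+-comm r (q * M))))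
          (∑-periodic (sifted-periodic ℓ prime-ℓ z) q r)))
        (trans (ι-+ (q * density ℓ prime-ℓ z) R) (cong (ℚ._+ ι R)
          (trans (ι-* q (density ℓ prime-ℓ z)) (cong (ι q ℚ.*_) (density-P ℓ prime-ℓ z)))))

      r≤M : ι r ℚ.≤ ι M
      r≤M = ι-mono (ℕ.<⇒≤ (ℕ.m%n<n N M ⦃ modulus≢0 ℓ prime-ℓ z ⦄))

      R≤r : ι R ℚ.≤ ι r
      R≤r = ι-mono (ℕ.≤-trans (∑-mono (λ n → 𝟙≤1 (Sifted? ℓ prime-ℓ z n)) r) (ℕ.≤-reflexive (∑-one r)))

    -- With N = qM + r the q full periods match P(z) qM exactly; the incomplete one and P(z) r both
    -- lie between 0 and r ≤ M.
    siftedCount≤ : ι (siftedCount ℓ prime-ℓ z N) ℚ.≤ Π z ℚ.* ι N ℚ.+ ι M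
    siftedCount≤ = subst₂ (λ a n → a ℚ.≤ Π z ℚ.* n ℚ.+ ι M) (sym A≡) (sym N≡)
      (≤-slack (≤⇒0≤ r≤M ⊕ ≤⇒0≤ R≤r ⊕ 0≤P ℓ prime-ℓ z ⊗ 0≤ι r)
        (solve 5 (λ p q m r s → p :* (q :* m :+ r) :+ m := (q :* (p :* m) :+ s) :+ ((m :- r) :+ (r :- s) :+ p :* r)) refl
          (Π z) (ι q) (ι M) (ι r) (ι R)))

    siftedCount≥ : Π z ℚ.* ι N ℚ.≤ ι (siftedCount ℓ prime-ℓ z N) ℚ.+ ι M
    siftedCount≥ = subst₂ (λ a n → Π z ℚ.* n ℚ.≤ a ℚ.+ ι M) (sym A≡) (sym N≡)
      (≤-slack (≤⇒0≤ r≤M ⊕ 0≤ι R ⊕ ≤⇒0≤ (P≤1 ℓ prime-ℓ z) ⊗ 0≤ι r)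
        (solve 5 (λ p q m r s → (q :* (p :* m) :+ s) :+ m := p :* (q :* m :+ r) :+ ((m :- r) :+ s :+ (con 1ℚ :- p) :* r)) refl
          (Π z) (ι q) (ι M) (ι r) (ι R)))

-- Real numbers

∣-∣≤⇒≤ : ∀ {p q r} → ℚ.∣ p ℚ.- q ∣ ℚ.≤ r → p ℚ.≤ q ℚ.+ r
∣-∣≤⇒≤ {p} {q} {r} ∣p-q∣≤r = ≤-slack (≤⇒0≤ (ℚ.≤-trans (p≤∣p∣ (p ℚ.- q)) ∣p-q∣≤r))
  (solve 3 (λ p q r → q :+ r := p :+ (r :- (p :- q))) refl p q r)
  where
  p≤∣p∣ : ∀ p → p ℚ.≤ ℚ.∣ p ∣
  p≤∣p∣ p = [ ℚ.≤-reflexive ∘ sym , negative ]′ (ℚ.∣p∣≡p∨∣p∣≡-p p)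
    where
    negative : ℚ.∣ p ∣ ≡ ℚ.- p → p ℚ.≤ ℚ.∣ p ∣
    negative eq = ≤-slack (ℚ.0≤∣p∣ p ⊕ ℚ.0≤∣p∣ p) (trans (solve 2 (λ p a → a := p :+ (a :+ (:- p))) refl p ℚ.∣ p ∣)
      (cong (λ t → p ℚ.+ (ℚ.∣ p ∣ ℚ.+ t)) (sym eq)))

0<½* : ∀ {ε} → 0ℚ ℚ.< ε → 0ℚ ℚ.< ½ ℚ.* ε
0<½* = *-positive (ℚ.positive⁻¹ ½)

-- The second alternative keeps a gap, so that it refutes x ≤ᴿ y.
dichotomy : ∀ x y {ε} → 0ℚ ℚ.< ε →
  (∃[ N ] ∀ n → N ≤ n → seq x n ℚ.≤ seq y n ℚ.+ ε) ⊎
  (∃[ N ] ∀ n → N ≤ n → seq y n ℚ.+ ½ ℚ.* (½ ℚ.* ε) ℚ.≤ seq x n)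
dichotomy x y {ε} 0<ε = decide (seq x N ℚ.≤? seq y N ℚ.+ ½ ℚ.* ε)
  where
  -- The sequences are compared once, at index N, against the threshold ε/2. Moving to index n costs
  -- 2η = ε/4: the first case keeps 3ε/4 ≤ ε, the second the gap ε/4.
  η = ½ ℚ.* (½ ℚ.* (½ ℚ.* ε))
  0<η = 0<½* (0<½* (0<½* 0<ε))
  hx = cauchy x η 0<η
  hy = cauchy y η 0<η
  N = proj₁ hx ⊔ proj₁ hy
  module _ {m n} (N≤m : N ≤ m) (N≤n : N ≤ n) where
    x≤ : seq x m ℚ.≤ seq x n ℚ.+ η
    x≤ = ∣-∣≤⇒≤ {seq x m} (proj₂ hx m n (ℕ.m⊔n≤o⇒m≤o _ _ N≤m) (ℕ.m⊔n≤o⇒m≤o _ _ N≤n))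
    y≤ : seq y m ℚ.≤ seq y n ℚ.+ η
    y≤ = ∣-∣≤⇒≤ {seq y m} (proj₂ hy m n (ℕ.m⊔n≤o⇒n≤o (proj₁ hx) _ N≤m) (ℕ.m⊔n≤o⇒n≤o (proj₁ hx) _ N≤n))
  ε/4≥0 : 0ℚ ℚ.≤ ½ ℚ.* (½ ℚ.* ε)
  ε/4≥0 = ℚ.<⇒≤ (0<½* (0<½* 0<ε))
  decide : Dec (seq x N ℚ.≤ seq y N ℚ.+ ½ ℚ.* ε) → _
  decide (yes x≤y) = inj₁ (N , λ n N≤n → ≤-slack
    (≤⇒0≤ x≤y ⊕ ≤⇒0≤ (x≤ N≤n ℕ.≤-refl) ⊕ ≤⇒0≤ (y≤ ℕ.≤-refl N≤n) ⊕ ε/4≥0)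
    (solve 5 (λ x y x′ y′ e → let η = con ½ :* (con ½ :* (con ½ :* e)) in
      y′ :+ e := x′ :+ (((y :+ con ½ :* e) :- x) :+ ((x :+ η) :- x′) :+ ((y′ :+ η) :- y) :+ con ½ :* (con ½ :* e)))
      refl (seq x N) (seq y N) (seq x n) (seq y n) ε))
  decide (no x≰y) = inj₂ (N , λ n N≤n → ≤-slack
    (≤⇒0≤ (ℚ.<⇒≤ (ℚ.≰⇒> x≰y)) ⊕ ≤⇒0≤ (x≤ ℕ.≤-refl N≤n) ⊕ ≤⇒0≤ (y≤ N≤n ℕ.≤-refl))
    (solve 5 (λ x y x′ y′ e → let η = con ½ :* (con ½ :* (con ½ :* e)) in
      x′ := (y′ :+ con ½ :* (con ½ :* e)) :+ ((x :- (y :+ con ½ :* e)) :+ ((x′ :+ η) :- x) :+ ((y :+ η) :- y′)))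
      refl (seq x N) (seq y N) (seq x n) (seq y n) ε))

gap⇒≰ : ∀ x y {ε} → 0ℚ ℚ.< ε →
  (∃[ N ] ∀ n → N ≤ n → seq y n ℚ.+ ½ ℚ.* ε ℚ.≤ seq x n) → ¬ (x ≤ᴿ y)
gap⇒≰ x y {ε} 0<ε (M , gap) x≤y = ℚ.<-irrefl refl (ℚ.<-≤-trans (0<½* 0<ε′) (≤-slack (≤⇒0≤ (gap n (ℕ.m≤m⊔n M N)) ⊕ ≤⇒0≤ (h n (ℕ.m≤n⊔m M N)))
    (solve 3 (λ x y e → con 0ℚ := con ½ :* (con ½ :* e) :+ ((x :- (y :+ con ½ :* e)) :+ ((y :+ con ½ :* (con ½ :* e)) :- x)))
      refl (seq x n) (seq y n) ε)))
  where
  0<ε′ = 0<½* 0<ε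
  N = proj₁ (x≤y _ (0<½* 0<ε′))
  h = proj₂ (x≤y _ (0<½* 0<ε′))
  n = M ⊔ N

-- For each ε the dichotomy is decided outright, and its gap alternative is refuted by the double
-- negation.
≤ᴿ-stable : ∀ x y → ¬ ¬ (x ≤ᴿ y) → x ≤ᴿ y
≤ᴿ-stable x y ¬¬x≤y ε 0<ε =
  [ id , (λ gap → ⊥-elim (¬¬x≤y (gap⇒≰ x y (0<½* 0<ε) gap))) ]′ (dichotomy x y 0<ε)

≰ᴿ⇒≥ᴿ : ∀ x y → ¬ (x ≤ᴿ y) → y ≤ᴿ x
≰ᴿ⇒≥ᴿ x y x≰y ε 0<ε =
  [ id , (λ (N , gap) → ⊥-elim (x≰y λ ε′ 0<ε′ → N , λ n N≤n → ≤-slack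
    (≤⇒0≤ (gap n N≤n) ⊕ ℚ.<⇒≤ (0<½* (0<½* 0<ε)) ⊕ ℚ.<⇒≤ 0<ε′)
    (solve 4 (λ x y e e′ → y :+ e′ := x :+ ((y :- (x :+ e)) :+ e :+ e′)) refl (seq x n) (seq y n) (½ ℚ.* (½ ℚ.* ε)) ε′))) ]′
  (dichotomy y x 0<ε)

≤ᴿ-trans : ∀ x y z → x ≤ᴿ y → y ≤ᴿ z → x ≤ᴿ z
≤ᴿ-trans x y z x≤y y≤z ε 0<ε =
  let M , p = x≤y (½ ℚ.* ε) (0<½* 0<ε)
      N , q = y≤z (½ ℚ.* ε) (0<½* 0<ε)
  in M ⊔ N , λ n h → ≤-slack (≤⇒0≤ (p n (ℕ.m⊔n≤o⇒m≤o M N h)) ⊕ ≤⇒0≤ (q n (ℕ.m⊔n≤o⇒n≤o M N h)))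
    (solve 4 (λ x y z e → z :+ e := x :+ (((y :+ con ½ :* e) :- x) :+ ((z :+ con ½ :* e) :- y)))
      refl (seq x n) (seq y n) (seq z n) ε)

fromℕ-mono : ∀ {m n} → m ≤ n → fromℕ m ≤ᴿ fromℕ n
fromℕ-mono {m} {n} m≤n ε 0<ε = 0 , λ _ _ → subst₂ (λ a b → a ℚ.≤ b ℚ.+ ε) (sym (ι-def m)) (sym (ι-def n))
  (≤-slack (≤⇒0≤ (ι-mono m≤n) ⊕ ℚ.<⇒≤ 0<ε) (solve 3 (λ a b e → b :+ e := a :+ ((b :- a) :+ e)) refl (ι m) (ι n) ε))

fromℕ-suc≰ : ∀ n → ¬ (fromℕ (suc n) ≤ᴿ fromℕ n)
fromℕ-suc≰ n = gap⇒≰ (fromℕ (suc n)) (fromℕ n) (ℚ.positive⁻¹ 1ℚ) (0 , λ _ _ →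
  subst₂ (λ a b → b ℚ.+ ½ ℚ.* 1ℚ ℚ.≤ a) (sym (ι-def (suc n))) (sym (ι-def n))
    (≤-slack (ℚ.nonNegative⁻¹ ½) (trans (trans (ι-+ 1 n) (cong (ℚ._+ ι n) ι-1))
      (solve 1 (λ a → con 1ℚ :+ a := (a :+ con ½ :* con 1ℚ) :+ con ½) refl (ι n)))))

natural-bound : ∀ x → ∃[ b ] x ≤ᴿ fromℕ b
natural-bound x =
  let N , h = cauchy x 1ℚ (ℚ.positive⁻¹ 1ℚ)
      b , x+1≤b = archimedean (seq x N ℚ.+ 1ℚ)
  in b , λ ε 0<ε → N , λ n N≤n → subst (λ t → seq x n ℚ.≤ t ℚ.+ ε) (sym (ι-def b))
    (≤-slack (≤⇒0≤ (∣-∣≤⇒≤ {seq x n} (h n N N≤n ℕ.≤-refl)) ⊕ ≤⇒0≤ x+1≤b ⊕ ℚ.<⇒≤ 0<ε)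
      (solve 4 (λ x y b e → b :+ e := x :+ (((y :+ con 1ℚ) :- x) :+ (b :- (y :+ con 1ℚ)) :+ e))
        refl (seq x n) (seq x N) (ι b) ε))

record IsFloor (X : ℝ) (N : ℕ) : Set where
  field
    floor≤ : fromℕ N ≤ᴿ X
    maximal : ¬ (fromℕ (suc N) ≤ᴿ X)

  ≤⇒fromℕ≤ : ∀ {n} → n ≤ N → fromℕ n ≤ᴿ X
  ≤⇒fromℕ≤ {n} n≤N = ≤ᴿ-trans (fromℕ n) (fromℕ N) X (fromℕ-mono n≤N) floor≤

  fromℕ≤⇒≤ : ∀ {n} → fromℕ n ≤ᴿ X → n ≤ N
  fromℕ≤⇒≤ {n} n≤X = ℕ.≮⇒≥ λ N<n → maximal (≤ᴿ-trans (fromℕ (suc N)) (fromℕ n) X (fromℕ-mono N<n) n≤X)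

  ≤floor+1 : X ≤ᴿ fromℕ (suc N)
  ≤floor+1 = ≰ᴿ⇒≥ᴿ (fromℕ (suc N)) X maximal

-- Descent from a natural number above X. As `_≤ᴿ_` is not decidable, each step argues under the
-- assumption that there is no floor: then b + 1 ≰ X forces b ≰ X, down to 0 ≰ X.
floor : ∀ X → fromℕ 0 ≤ᴿ X → ¬ ¬ (∃[ N ] IsFloor X N)
floor X 0≤X = let b , X≤b = natural-bound X in search (suc b)
    (λ 1+b≤X → fromℕ-suc≰ b (≤ᴿ-trans (fromℕ (suc b)) X (fromℕ b) 1+b≤X X≤b))
  where
  search : ∀ b → ¬ (fromℕ b ≤ᴿ X) → ¬ ¬ (∃[ N ] IsFloor X N)
  search zero    0≰X   _      = 0≰X 0≤X
  search (suc b) 1+b≰X ¬floor = search b (λ b≤X → ¬floor (b , record { floor≤ = b≤X ; maximal = 1+b≰X })) ¬floor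

-- Squarefree arguments and hits up to the integer part of X

unique-length : ∀ {xs ys : List ℕ} → Unique xs → Unique ys → (∀ {n} → n ∈ xs → n ∈ ys) → (∀ {n} → n ∈ ys → n ∈ xs) →
  length xs ≡ length ys
unique-length {xs} {ys} uxs uys xs⊆ys ys⊆xs = ℕ.≤-antisym
  (pigeonhole id xs ys uxs xs⊆ys (λ _ _ → id)) (pigeonhole id ys xs uys ys⊆xs (λ _ _ → id))

module _ (ℓ : ℕ) (prime-ℓ : Prime ℓ) {X : ℝ} {N : ℕ} (isFloor : IsFloor X N)
         (b : ℕ) (φ≤b : ∀ n → n < suc N → φ ℓ n ≤ b) where
  open IsFloor isFloor

  -- The extra one is the argument 0, which passes the sieve but is not among the n ≥ 1.
  squarefree-count : ∀ {k} → HasCardinality (SquareFreeArguments ℓ X) k → suc k ≡ siftedCount ℓ prime-ℓ b (suc N)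
  squarefree-count {k} (xs , unique , length≡k , xs⇔) = begin
    suc k                                     ≡⟨ cong suc length≡k ⟨
    length (0 ∷ xs)                           ≡⟨ unique-length (0∉xs ∷ unique) (unique-count S? (suc N)) to from ⟩
    count S? (suc N)                          ≡⟨ count≡∑ S? (suc N) ⟩
    siftedCount ℓ prime-ℓ b (suc N)           ∎
    where
    open ≡-Reasoning
    S? = Sifted? ℓ prime-ℓ b
    0∉xs : All (0 ≢_) xs
    0∉xs = All.tabulate λ { {n} n∈xs refl → contradiction (proj₁ (Equivalence.to (xs⇔ n) n∈xs)) λ () }
    sifted-0 : Sifted ℓ prime-ℓ b 0
    sifted-0 {p} _ (prime-p , p²∣φ0) = prime∤1 prime-p
      (ℕ.∣-trans (ℕ.m∣m*n (p ^ 1)) (root-coprime ℓ prime-ℓ 0 p²∣φ0 ((p ^ 2) ℕ.∣0)))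
    to : ∀ {n} → n ∈ 0 ∷ xs → n ∈ filter S? (upTo (suc N))
    to (here refl)      = ∈-count⁺ S? (s≤s z≤n) sifted-0
    to {n} (there n∈xs) = let _ , n≤X , sf = Equivalence.to (xs⇔ n) n∈xs in
      ∈-count⁺ S? (s≤s (fromℕ≤⇒≤ n≤X)) (squarefree⇒sifted ℓ prime-ℓ sf)
    from : ∀ {n} → n ∈ filter S? (upTo (suc N)) → n ∈ 0 ∷ xs
    from {zero}  _  = here refl
    from {suc n} n∈ = there (member (∈-count⁻ S? {suc N} n∈))
      where
      member : suc n < suc N × Sifted ℓ prime-ℓ b (suc n) → suc n ∈ xs
      member (s≤s n≤N , sifted) = Equivalence.from (xs⇔ (suc n))
        (s≤s z≤n , ≤⇒fromℕ≤ n≤N , sifted⇒squarefree ℓ prime-ℓ (φ≤b (suc n) (s≤s n≤N)) sifted)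

  -- The hypothesis on S² speaks about every k that is its cardinality, so one must be exhibited.
  -- The set is finite because p ≤ Φ_ℓ(n) ≤ b, and R_ℓ(p²) ≤ X as soon as some n ≤ ⌊X⌋ is a root, by
  -- minimality.
  S²-count : HasCardinality (S² ℓ X) (∑ (𝟙 ∘ Hit? ℓ prime-ℓ (suc N)) (suc b))
  S²-count = filter H? (upTo (suc b)) , unique-count H? (suc b) , count≡∑ H? (suc b) , λ p → mk⇔
    (λ p∈ → hit⇒S² (proj₂ (∈-count⁻ H? {suc b} p∈)))
    (λ s → let hit = S²⇒hit s in ∈-count⁺ H? (s≤s (bounded hit)) hit)
    where
    H? = Hit? ℓ prime-ℓ (suc N)
    hit⇒S² : ∀ {p} → Hit ℓ prime-ℓ (suc N) p → S² ℓ X p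
    hit⇒S² {p} (prime-p , n , s≤s n≤N , p²∣φn) =
      let d , minimal , d≤n = least (λ e → p ^ 2 ∣? φ ℓ e) n p²∣φn
      in (prime-p , n , ℕ.∣-trans (ℕ.m∣m*n (p ^ 1)) p²∣φn) , d , minimal , ≤⇒fromℕ≤ (ℕ.≤-trans d≤n n≤N)
    S²⇒hit : ∀ {p} → S² ℓ X p → Hit ℓ prime-ℓ (suc N) p
    S²⇒hit ((prime-p , _) , d , (p²∣φd , _) , d≤X) = prime-p , d , s≤s (fromℕ≤⇒≤ d≤X) , p²∣φd
    bounded : ∀ {p} → Hit ℓ prime-ℓ (suc N) p → p ≤ b
    bounded (prime-p , n , n<1+N , p²∣φn) = ℕ.≤-trans (prime-bounded ℓ prime-ℓ (prime-p , p²∣φn)) (φ≤b n n<1+N)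

-- k is the number of squarefree values in [1, N′), b = 1 + k the count that
-- includes 0, a the count sifted by the primes up to z only.
counting-error : ∀ {p pz x n′ w a b k m t e} →
  0ℚ ℚ.≤ p → p ℚ.≤ 1ℚ → p ℚ.≤ pz → pz ℚ.≤ p ℚ.+ w → w ℚ.≤ e → 0ℚ ℚ.≤ e →
  0ℚ ℚ.≤ n′ → x ℚ.≤ n′ ℚ.+ 1ℚ → n′ ℚ.≤ x ℚ.+ (1ℚ ℚ.+ 1ℚ) →
  b ℚ.≤ a → a ℚ.≤ b ℚ.+ w ℚ.* n′ ℚ.+ t → t ℚ.≤ e ℚ.* (x ℚ.+ 1ℚ) →
  a ℚ.≤ pz ℚ.* n′ ℚ.+ m → pz ℚ.* n′ ℚ.≤ a ℚ.+ m → b ≡ 1ℚ ℚ.+ k →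
  ℚ.∣ k ℚ.- p ℚ.* x ∣ ℚ.≤ 1ℚ ℚ.+ 1ℚ ℚ.+ m ℚ.+ e ℚ.* (n′ ℚ.+ n′ ℚ.+ (1ℚ ℚ.+ 1ℚ))
counting-error {p} {pz} {x} {n′} {w} {a} {b} {k} {m} {t} {e}
  0≤p p≤1 p≤pz pz≤p+w w≤e 0≤e 0≤n′ x≤n′+1 n′≤x+2 b≤a a≤b+wn′+t t≤e[x+1] a≤ ≤a refl = ∣-∣≤ {k} {p ℚ.* x}
  (≤-slack (≤⇒0≤ b≤a ⊕ ≤⇒0≤ a≤ ⊕ ≤⇒0≤ pz≤p+w ⊗ 0≤n′ ⊕ ≤⇒0≤ w≤e ⊗ 0≤n′ ⊕ 0≤p ⊗ ≤⇒0≤ n′≤x+2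
      ⊕ (≤⇒0≤ p≤1 ⊕ ≤⇒0≤ p≤1) ⊕ (ℚ.nonNegative⁻¹ 1ℚ ⊕ 0≤e ⊗ (0≤n′ ⊕ (ℚ.nonNegative⁻¹ 1ℚ ⊕ ℚ.nonNegative⁻¹ 1ℚ))))
    (solve 9 (λ p pz x n w a k m e → let one = con 1ℚ ; two = one :+ one in
      p :* x :+ (one :+ one :+ m :+ e :* (n :+ n :+ two)) :=
      k :+ ((a :- (one :+ k)) :+ ((pz :* n :+ m) :- a) :+ ((p :+ w) :- pz) :* n :+ (e :- w) :* n :+ p :* ((x :+ two) :- n)
        :+ ((one :- p) :+ (one :- p)) :+ (one :+ e :* (n :+ two))))
      refl p pz x n′ w a k m e))
  -- This direction fixes the error term: p x ≤ pz n′ + 1 ≤ a + m + 1, and a exceeds 1 + k by at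
  -- most e n′ + e (x + 1) ≤ e (2n′ + 2).
  (≤-slack (0≤p ⊗ ≤⇒0≤ x≤n′+1 ⊕ ≤⇒0≤ p≤1 ⊕ ≤⇒0≤ p≤pz ⊗ 0≤n′ ⊕ ≤⇒0≤ ≤a ⊕ ≤⇒0≤ a≤b+wn′+t ⊕ ≤⇒0≤ w≤e ⊗ 0≤n′
      ⊕ ≤⇒0≤ t≤e[x+1] ⊕ 0≤e ⊗ ≤⇒0≤ x≤n′+1)
    (solve 10 (λ p pz x n w a k m t e → let one = con 1ℚ ; two = one :+ one in
      k :+ (one :+ one :+ m :+ e :* (n :+ n :+ two)) :=
      p :* x :+ (p :* ((n :+ one) :- x) :+ (one :- p) :+ (pz :- p) :* n :+ ((a :+ m) :- pz :* n)
        :+ (((one :+ k) :+ w :* n :+ t) :- a) :+ (e :- w) :* n :+ (e :* (x :+ one) :- t) :+ e :* ((n :+ one) :- x)))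
      refl p pz x n′ w a k m t e))

-- The asymptotic formula

module _ (ℓ : ℕ) (prime-ℓ : Prime ℓ) where

  private
    L c : ℚ
    L = ι ℓ
    c = proj₁ (P-bounded-below ℓ prime-ℓ)
    0<c : 0ℚ ℚ.< c
    0<c = proj₁ (proj₂ (P-bounded-below ℓ prime-ℓ))
    c≤P : ∀ n → c ℚ.≤ P ℓ prime-ℓ n
    c≤P = proj₂ (proj₂ (P-bounded-below ℓ prime-ℓ))

  product-limit : ℝ
  product-limit = mkℝ (partialProduct ℓ) λ ε 0<ε → let N , h = P-cauchy ℓ prime-ℓ ε 0<ε in
    N , λ m n N≤m N≤n → subst₂ (λ a b → ℚ.∣ a ℚ.- b ∣ ℚ.≤ ε)
      (P≡partialProduct ℓ prime-ℓ m) (P≡partialProduct ℓ prime-ℓ n) (h m n N≤m N≤n)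

  product-converges : partialProduct ℓ ⟶ product-limit
  product-converges ε 0<ε = let N , h = cauchy product-limit ε 0<ε in
    N , λ n N≤n ε′ 0<ε′ → N , λ m N≤m → ≤-slack (≤⇒0≤ (h n m N≤n N≤m) ⊕ ℚ.<⇒≤ 0<ε′)
      (solve 3 (λ d e e′ → e :+ e′ := d :+ ((e :- d) :+ e′)) refl ℚ.∣ partialProduct ℓ n ℚ.- partialProduct ℓ m ∣ ε ε′)

  module _ (ε : ℚ) (0<ε : 0ℚ ℚ.< ε) where

    private
      e ε₁ : ℚ
      -- The total error is about 2eX, while 4eX = εcX ≤ ε C X; the spare 2eX absorbs the constants.
      -- Below, `ε₁` = e/ℓ, so that ℓ |S²(ℓ, X)| stays within e(x + 1).
      e = ½ ℚ.* (½ ℚ.* (ε ℚ.* c))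
      ε₁ = e ℚ.* u (ℕ.pred ℓ)
      0<e : 0ℚ ℚ.< e
      0<e = 0<½* (0<½* (*-positive 0<ε 0<c))
      0<ε₁ : 0ℚ ℚ.< ε₁
      0<ε₁ = *-positive 0<e (0<u (ℕ.pred ℓ))

      Lε₁≡e : L ℚ.* ε₁ ≡ e
      Lε₁≡e = begin
        L ℚ.* (e ℚ.* u (ℕ.pred ℓ))                       ≡⟨ solve 3 (λ l e v → l :* (e :* v) := e :* (v :* l)) refl L e (u (ℕ.pred ℓ)) ⟩
        e ℚ.* (u (ℕ.pred ℓ) ℚ.* L)                       ≡⟨ cong (λ k → e ℚ.* (u (ℕ.pred ℓ) ℚ.* ι k)) (ℕ.suc-pred ℓ ⦃ prime⇒nonZero prime-ℓ ⦄) ⟨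
        e ℚ.* (u (ℕ.pred ℓ) ℚ.* ι (suc (ℕ.pred ℓ)))      ≡⟨ cong (e ℚ.*_) (u-inverse (ℕ.pred ℓ)) ⟩
        e ℚ.* 1ℚ                                         ≡⟨ ℚ.*-identityʳ e ⟩
        e                                                ∎
        where open ≡-Reasoning

      cut : ∃[ z ] ℓ ≤ z × L ℚ.* u z ℚ.≤ e
      cut = small-u 0<e ℓ
      z : ℕ
      z = proj₁ cut
      ℓ≤1+z : ℓ ≤ suc z
      ℓ≤1+z = ℕ.m≤n⇒m≤1+n (proj₁ (proj₂ cut))
      m ten : ℚ
      m = ι (modulus ℓ prime-ℓ (suc z))
      ten = ι 10

      -- The 10 is 2 + 8: the 2 of e(2n′ + 2), and 4e(n′ - x) ≤ 8e for replacing n′ by x in 4en′.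
      start : ∃[ K ] 1ℚ ℚ.+ 1ℚ ℚ.+ m ℚ.+ e ℚ.* ten ℚ.≤ e ℚ.* ι K
      start = archimedean-* 0<e (1ℚ ℚ.+ 1ℚ ℚ.+ m ℚ.+ e ℚ.* ten)
      K : ℕ
      K = proj₁ start

    error≤ : ∀ {N n x} → suc K ≤ N → ι (suc N) ℚ.≤ x ℚ.+ (1ℚ ℚ.+ 1ℚ) →
      1ℚ ℚ.+ 1ℚ ℚ.+ m ℚ.+ e ℚ.* (ι (suc N) ℚ.+ ι (suc N) ℚ.+ (1ℚ ℚ.+ 1ℚ)) ℚ.≤ ε ℚ.* ℚ.∣ P ℓ prime-ℓ n ℚ.* x ∣
    error≤ {N} {n} {x} K<N n′≤x+2 = subst (λ t → W ℚ.≤ ε ℚ.* t) (sym (ℚ.0≤p⇒∣p∣≡p (0≤P ℓ prime-ℓ n ⊗ 0≤x)))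
      (≤-slack
        (≤⇒0≤ (proj₂ start) ⊕ ℚ.<⇒≤ 0<e ⊗ ≤⇒0≤ K≤n′ ⊕ ℚ.<⇒≤ 0<e ⊗ 0≤ι (suc N)
          ⊕ ℚ.<⇒≤ 0<e ⊗ (four ⊗ ≤⇒0≤ n′≤x+2) ⊕ ℚ.<⇒≤ 0<ε ⊗ ≤⇒0≤ (c≤P n) ⊗ 0≤x)
        (trans (solve 7 (λ ε p c x m k n → let e = con ½ :* (con ½ :* (ε :* c)) ; one = con 1ℚ ; two = one :+ one ; ten = con (+ 10 ℚ./ 1) in
          ε :* (p :* x) :=
          (two :+ m :+ e :* (n :+ n :+ two))
            :+ ((e :* k :- (two :+ m :+ e :* ten)) :+ e :* (n :- k) :+ e :* n :+ e :* ((two :+ two) :* ((x :+ two) :- n))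
              :+ ε :* (p :- c) :* x)) refl ε (P ℓ prime-ℓ n) c x m (ι K) n′)
          (cong (λ ten → W ℚ.+ ((e ℚ.* ι K ℚ.- (1ℚ ℚ.+ 1ℚ ℚ.+ m ℚ.+ e ℚ.* ten)) ℚ.+ e ℚ.* (n′ ℚ.- ι K) ℚ.+ e ℚ.* n′
            ℚ.+ e ℚ.* ((1ℚ ℚ.+ 1ℚ ℚ.+ (1ℚ ℚ.+ 1ℚ)) ℚ.* ((x ℚ.+ (1ℚ ℚ.+ 1ℚ)) ℚ.- n′)) ℚ.+ ε ℚ.* (P ℓ prime-ℓ n ℚ.- c) ℚ.* x)) (ι-def 10))))
      where
      n′ W : ℚ
      n′ = ι (suc N)
      W = 1ℚ ℚ.+ 1ℚ ℚ.+ m ℚ.+ e ℚ.* (n′ ℚ.+ n′ ℚ.+ (1ℚ ℚ.+ 1ℚ))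
      four : 0ℚ ℚ.≤ 1ℚ ℚ.+ 1ℚ ℚ.+ (1ℚ ℚ.+ 1ℚ)
      four = ℚ.nonNegative⁻¹ (1ℚ ℚ.+ 1ℚ ℚ.+ (1ℚ ℚ.+ 1ℚ))
      K≤n′ : ι K ℚ.≤ n′
      K≤n′ = ι-mono (ℕ.≤-trans (ℕ.n≤1+n K) (ℕ.m≤n⇒m≤1+n K<N))
      2≤n′ : 1ℚ ℚ.+ 1ℚ ℚ.≤ n′
      2≤n′ = subst (ℚ._≤ n′) (trans (ι-+ 1 1) (cong₂ ℚ._+_ ι-1 ι-1)) (ι-mono (s≤s (ℕ.≤-trans (s≤s z≤n) K<N)))
      0≤x : 0ℚ ℚ.≤ x
      0≤x = ≤-slack (≤⇒0≤ 2≤n′ ⊕ ≤⇒0≤ n′≤x+2)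
        (solve 2 (λ x n → x := con 0ℚ :+ ((n :- (con 1ℚ :+ con 1ℚ)) :+ ((x :+ (con 1ℚ :+ con 1ℚ)) :- n))) refl x n′)

    squarefree-density : ∣ S² ℓ ∣=o (λ T → T) → Eventually λ X → ∀ k → HasCardinality (SquareFreeArguments ℓ X) k →
      ∣ fromℕ k -ᴿ product-limit *ᴿ X ∣ᴿ ≤ᴿ fromℚ ε *ᴿ ∣ product-limit *ᴿ X ∣ᴿ
    -- B lies above the threshold of the hypothesis on S², and `suc K` gives N ≥ K + 1 ≥ 1, which
    -- also makes the approximations of X nonnegative. A sum of naturals takes the place of a
    -- maximum of reals.
    squarefree-density S²=o = fromℕ (B + suc K) , λ X X₀≤X k card →
      ≤ᴿ-stable ∣ fromℕ k -ᴿ product-limit *ᴿ X ∣ᴿ (fromℚ ε *ᴿ ∣ product-limit *ᴿ X ∣ᴿ) λ ≰ →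
        floor X (≤ᴿ-trans (fromℕ 0) (fromℕ (B + suc K)) X (fromℕ-mono {0} {B + suc K} z≤n) X₀≤X)
          λ (N , isFloor) → ≰ (bound X X₀≤X card isFloor)
      where
      X₁ : ℝ
      X₁ = proj₁ (S²=o ε₁ 0<ε₁)
      B : ℕ
      B = proj₁ (natural-bound X₁)

      bound : ∀ X → fromℕ (B + suc K) ≤ᴿ X → ∀ {k} → HasCardinality (SquareFreeArguments ℓ X) k → ∀ {N} → IsFloor X N →
        ∣ fromℕ k -ᴿ product-limit *ᴿ X ∣ᴿ ≤ᴿ fromℚ ε *ᴿ ∣ product-limit *ᴿ X ∣ᴿ
      bound X X₀≤X {k} card {N} isFloor ε′ 0<ε′ = suc z ⊔ (n₁ ⊔ (n₂ ⊔ n₃)) , λ n h →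
        let z<n = ℕ.m⊔n≤o⇒m≤o (suc z) (n₁ ⊔ (n₂ ⊔ n₃)) h
            h₁  = ℕ.m⊔n≤o⇒n≤o (suc z) (n₁ ⊔ (n₂ ⊔ n₃)) h
            h₂  = ℕ.m⊔n≤o⇒n≤o n₁ (n₂ ⊔ n₃) h₁
        in conclude n z<n
             (proj₂ lower n (ℕ.m⊔n≤o⇒m≤o n₁ (n₂ ⊔ n₃) h₁))
             (proj₂ upper n (ℕ.m⊔n≤o⇒m≤o n₂ n₃ h₂))
             (proj₂ few n (ℕ.m⊔n≤o⇒n≤o n₂ n₃ h₂))
        where
        open IsFloor isFloor
        K<N : suc K ≤ N
        K<N = ℕ.≤-trans (ℕ.m≤n+m (suc K) B) (fromℕ≤⇒≤ X₀≤X)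
        X₁≤X : X₁ ≤ᴿ X
        X₁≤X = ≤ᴿ-trans X₁ (fromℕ B) X (proj₂ (natural-bound X₁))
          (≤ᴿ-trans (fromℕ B) (fromℕ (B + suc K)) X (fromℕ-mono {B} {B + suc K} (ℕ.m≤m+n B (suc K))) X₀≤X)

        b s : ℕ
        -- The sum is a crude bound for all values Φ_ℓ(n) with n ≤ N; the maximum with z lets the
        -- tail estimate start at z.
        b = z ⊔ ∑ (φ ℓ) (suc N)
        s = ∑ (𝟙 ∘ Hit? ℓ prime-ℓ (suc N)) (suc (suc b))
        n′ : ℚ
        n′ = ι (suc N)
        φ≤b : ∀ n → n < suc N → φ ℓ n ≤ suc b
        φ≤b n n≤N = ℕ.m≤n⇒m≤1+n (ℕ.≤-trans (term≤∑ (φ ℓ) n≤N) (ℕ.m≤n⊔m z _))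

        -- Slack 1 is enough here and below: N ≤ X < N + 1 becomes n′ ≤ x + 2 and x ≤ n′ + 1 with n′
        -- = N + 1. For the hits the slack `ε₁` turns e x into e(x + 1).
        lower : ∃[ n₁ ] ∀ n → n₁ ≤ n → + N ℚ./ 1 ℚ.≤ seq X n ℚ.+ 1ℚ
        lower = floor≤ 1ℚ (ℚ.positive⁻¹ 1ℚ)
        upper : ∃[ n₂ ] ∀ n → n₂ ≤ n → seq X n ℚ.≤ + suc N ℚ./ 1 ℚ.+ 1ℚ
        upper = ≤floor+1 1ℚ (ℚ.positive⁻¹ 1ℚ)
        few : ∃[ n₃ ] ∀ n → n₃ ≤ n → + s ℚ./ 1 ℚ.≤ ε₁ ℚ.* ℚ.∣ seq X n ∣ ℚ.+ ε₁
        few = proj₂ (S²=o ε₁ 0<ε₁) X X₁≤X s (S²-count ℓ prime-ℓ isFloor (suc b) φ≤b) ε₁ 0<ε₁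
        n₁ n₂ n₃ : ℕ
        n₁ = proj₁ lower
        n₂ = proj₁ upper
        n₃ = proj₁ few

        module _ (n : ℕ) (z<n : suc z ≤ n)
                 (N≤x+1 : + N ℚ./ 1 ℚ.≤ seq X n ℚ.+ 1ℚ)
                 (x≤N+2 : seq X n ℚ.≤ + suc N ℚ./ 1 ℚ.+ 1ℚ)
                 (s≤ε₁ : + s ℚ./ 1 ℚ.≤ ε₁ ℚ.* ℚ.∣ seq X n ∣ ℚ.+ ε₁) where
          private
            x p pz a q : ℚ
            x = seq X n
            p = P ℓ prime-ℓ n
            pz = P ℓ prime-ℓ (suc z)
            a = ι (siftedCount ℓ prime-ℓ (suc z) (suc N))
            q = ι (siftedCount ℓ prime-ℓ (suc b) (suc N))

          n′≤x+2 : n′ ℚ.≤ x ℚ.+ (1ℚ ℚ.+ 1ℚ)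
          n′≤x+2 = ≤-slack (≤⇒0≤ (subst (ℚ._≤ x ℚ.+ 1ℚ) (ι-def N) N≤x+1))
            (trans (solve 2 (λ x n → x :+ (con 1ℚ :+ con 1ℚ) := (con 1ℚ :+ n) :+ ((x :+ con 1ℚ) :- n)) refl x (ι N))
              (cong (ℚ._+ ((x ℚ.+ 1ℚ) ℚ.- ι N)) (sym (trans (ι-+ 1 N) (cong (ℚ._+ ι N) ι-1)))))

          0≤x : 0ℚ ℚ.≤ x
          0≤x = ≤-slack (≤⇒0≤ (subst (ℚ._≤ x ℚ.+ 1ℚ) (ι-def N) N≤x+1) ⊕ ≤⇒0≤ 1≤N)
            (solve 2 (λ x n → x := con 0ℚ :+ (((x :+ con 1ℚ) :- n) :+ (n :- con 1ℚ))) refl x (ι N))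
            where
            1≤N : 1ℚ ℚ.≤ ι N
            1≤N = subst (ℚ._≤ ι N) ι-1 (ι-mono (ℕ.≤-trans (s≤s z≤n) K<N))

          few-hits : L ℚ.* ι s ℚ.≤ e ℚ.* (x ℚ.+ 1ℚ)
          few-hits = begin
            L ℚ.* ι s                           ≡⟨ cong (L ℚ.*_) (ι-def s) ⟨
            L ℚ.* (+ s ℚ./ 1)                   ≤⟨ *-monoˡ (0≤ι ℓ) s≤ε₁ ⟩
            L ℚ.* (ε₁ ℚ.* ℚ.∣ x ∣ ℚ.+ ε₁)       ≡⟨ cong (λ t → L ℚ.* (ε₁ ℚ.* t ℚ.+ ε₁)) (ℚ.0≤p⇒∣p∣≡p 0≤x) ⟩
            L ℚ.* (ε₁ ℚ.* x ℚ.+ ε₁)             ≡⟨ solve 3 (λ l e x → l :* (e :* x :+ e) := l :* e :* (x :+ con 1ℚ)) refl L ε₁ x ⟩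
            L ℚ.* ε₁ ℚ.* (x ℚ.+ 1ℚ)             ≡⟨ cong (ℚ._* (x ℚ.+ 1ℚ)) Lε₁≡e ⟩
            e ℚ.* (x ℚ.+ 1ℚ)                    ∎
            where open ℚ.≤-Reasoning

          sieve : a ℚ.≤ q ℚ.+ L ℚ.* u z ℚ.* n′ ℚ.+ L ℚ.* ι s
          sieve = ℚ.≤-trans (siftedCount-tail ℓ prime-ℓ (suc N) ℓ≤1+z (ℕ.m≤m⊔n z _))
            (≤-slack (0≤ι ℓ ⊗ 0≤ι (suc N) ⊗ 0≤u b)
              (solve 6 (λ q l n x y s → q :+ l :* x :* n :+ l :* s := (q :+ l :* n :* (x :- y) :+ l :* s) :+ l :* n :* y) refl
                q L n′ (u z) (u b) (ι s)))

          P-close′ : ∀ n → suc z ≤ n → pz ℚ.≤ P ℓ prime-ℓ n ℚ.+ L ℚ.* u z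
          P-close′ (suc _) (s≤s h) = P-close ℓ prime-ℓ ℓ≤1+z h

          conclude : ℚ.∣ + k ℚ./ 1 ℚ.- partialProduct ℓ n ℚ.* x ∣ ℚ.≤ ε ℚ.* ℚ.∣ partialProduct ℓ n ℚ.* x ∣ ℚ.+ ε′
          conclude = subst₂ (λ k p → ℚ.∣ k ℚ.- p ℚ.* x ∣ ℚ.≤ ε ℚ.* ℚ.∣ p ℚ.* x ∣ ℚ.+ ε′)
            (sym (ι-def k)) (P≡partialProduct ℓ prime-ℓ n) (begin
              ℚ.∣ ι k ℚ.- p ℚ.* x ∣
                ≤⟨ counting-error {p} {pz} {x} {n′} {L ℚ.* u z} {a} {q} {ι k} {m} {L ℚ.* ι s} {e}
                     (0≤P ℓ prime-ℓ n) (P≤1 ℓ prime-ℓ n) (P-antitone ℓ prime-ℓ z<n) (P-close′ n z<n)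
                     (proj₂ (proj₂ cut)) (ℚ.<⇒≤ 0<e) (0≤ι (suc N))
                     (subst (λ t → x ℚ.≤ t ℚ.+ 1ℚ) (ι-def (suc N)) x≤N+2) n′≤x+2
                     (ι-mono (siftedCount-antitone ℓ prime-ℓ (suc N) (s≤s (ℕ.m≤m⊔n z _)))) sieve few-hits
                     (siftedCount≤ ℓ prime-ℓ (suc z) (suc N)) (siftedCount≥ ℓ prime-ℓ (suc z) (suc N))
                     (trans (cong ι (sym (squarefree-count ℓ prime-ℓ isFloor (suc b) φ≤b card)))
                       (trans (ι-+ 1 k) (cong (ℚ._+ ι k) ι-1))) ⟩
              1ℚ ℚ.+ 1ℚ ℚ.+ m ℚ.+ e ℚ.* (n′ ℚ.+ n′ ℚ.+ (1ℚ ℚ.+ 1ℚ))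
                ≤⟨ error≤ {N} {n} {x} K<N n′≤x+2 ⟩
              ε ℚ.* ℚ.∣ p ℚ.* x ∣
                ≤⟨ ≤-slack (ℚ.<⇒≤ 0<ε′) refl ⟩
              ε ℚ.* ℚ.∣ p ℚ.* x ∣ ℚ.+ ε′ ∎)
            where open ℚ.≤-Reasoning

theorem2 : (ℓ : ℕ) → Prime ℓ → ¬ (2 ∣ ℓ) →
    ∣ S² ℓ ∣=o (λ T → T) →
    ∃[ C ] (partialProduct ℓ ⟶ C × ∣ SquareFreeArguments ℓ ∣∼ (λ X → C *ᴿ X))
theorem2 ℓ prime-ℓ _ S²=o = product-limit ℓ prime-ℓ , product-converges ℓ prime-ℓ ,
  λ ε 0<ε → squarefree-density ℓ prime-ℓ ε 0<ε S²=o
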